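{- Let $G=(V,E)$ be a directed graph with $m=|E|$, let $H$ be a maximal eulerian subgraph of $G$, let $r:V\to\mathbb{Z}$ be a rank function conforming $H$, and let $(p,s)\in E(H)$ be an edge with $\mathrm{slack}((p,s),r)>0$. Then the running time of $\mathrm{Relief}(H,r,G,p,s)$ is $O(m+\mathrm{slack}((p,s),r))$.
   Context: Graphs are finite and directed, $G=(V,E)$, $n=|V|$, $m=|E|$; subgraphs of $G$ are taken on the same vertex set $V$, and $E(H)$ is the edge set of $H$. A rank function is a map $r:V\to\mathbb{Z}$. An edge $(u,v)$ is forward w.r.t. $r$ if $r(u)<r(v)$ and backward if $r(u)\ge r(v)$. Slack: $\mathrm{slack}((u,v),r)=\max(r(v)-r(u)-1,0)$. A graph is eulerian if every vertex has in-degree equal to out-degree (connectivity is not required). A subgraph $H$ of $G$ is a maximal eulerian subgraph if it is eulerian and no eulerian subgraph of $G$ has an edge set strictly containing $E(H)$. A rank function $r$ conforms $H$ if all edges of $G$ that are backward w.r.t. $r$ lie in $E(H)$. Algorithm Relief$(H,r,G,p,s)$. Input: a graph $G=(V,E)$, a maximal eulerian subgraph $H$, a rank function $r$ conforming $H$, and an edge $(p,s)\in E(H)$ with $\mathrm{slack}((p,s),r)>0$. (1) Set $F:=E(H)$, $r':=r$, $t(v):=0$ for all $v\in V$; then set $t(p):=r(s)-r(p)-1$ and let $S$ be a priority queue (largest priority first) containing only $p$, with priority $t(p)$. (2) While $S$ is not empty: pop a vertex $u$ of highest priority from $S$ and set $r'(u):=r'(u)+t(u)$. For each $(u,v)\in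 E\setminus F$ with $r'(v)\le r'(u)$: let $t:=r'(u)+1-r'(v)$; if $t>t(v)$, set $t(v):=t$, add $v$ to $S$ with priority $t$ (updating its priority if $v$ is already in $S$), and set $\mathrm{parent}(v):=u$. Then for each $e=(w,u)\in F$ with $\mathrm{slack}(e,r')>\mathrm{slack}(e,r)$: let $t:=\mathrm{slack}(e,r')-\mathrm{slack}(e,r)$; if $t>t(w)$, set $t(w):=t$, add $w$ to $S$ with priority $t$ (updating its priority if $w$ is already in $S$), and set $\mathrm{parent}(w):=u$. (3) After the loop, if $\mathrm{slack}((p,s),r')>0$: let $O$ be the set of edges of $E$ along the path from $s$ to $p$ obtained by following the parent links (for each vertex $x\ne p$ on this path, the edge joining $x$ and $\mathrm{parent}(x)$ is the one that was being processed when $\mathrm{parent}(x)$ was last set); replace $F$ by $(F\setminus O)\cup(O\setminus F)$ and then delete $(p,s)$ from $F$. (4) Return $H'=(V,F)$ and $r'$. Running time counts elementary operations (integer arithmetic and comparisons at unit cost), the priority queue being implemented by a suitable data structure. In running-time bounds, $n=O(m)$ is understood, so $O(n+m)$ is written $O(m)$. -}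

module Defs where

open import Data.Bool.Base using (Bool; true; false; if_then_else_; not; _∧_; _xor_)
open import Data.Fin.Base using (Fin; toℕ)
import Data.Fin.Properties as Fin
open import Data.Fin.Subset using (Subset; _∈_; _⊂_; _∩_; ∣_∣)
open import Data.Integer.Base using (ℤ; +_; 0ℤ; 1ℤ; _+_; _-_; _⊔_; _≤_; _<_)
import Data.Integer.Properties as ℤ
open import Data.List.Base using (List; []; _∷_; filter; allFin)
open import Data.List.Relation.Binary.Permutation.Propositional using (_↭_)
open import Data.Maybe.Base using (Maybe; just; nothing)
open import Data.Nat.Base as ℕ using (ℕ; suc; _≡ᵇ_)
open import Data.Product.Base using (_×_; _,_; proj₁; proj₂; ∃-syntax)
open import Data.Unit.Base using (⊤; tt)
open import Data.Vec.Base using (lookup; tabulate; _[_]≔_)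
open import Data.Vec.Functional using (updateAt)
open import Function.Base using (const; id)
open import Function.Bundles using (_⇔_)
open import Function.Definitions using (Injective)
open import Relation.Binary.PropositionalEquality.Core using (_≡_)
open import Relation.Nullary.Decidable.Core using (⌊_⌋)
open import Relation.Nullary.Negation.Core using (¬_)

-- E ⊆ V × V, its elements being numbered by Fin m; self-loops are allowed.
record Graph : Set where
  field
    n m            : ℕ
    ends           : Fin m → Fin n × Fin n
    ends-injective : Injective _≡_ _≡_ ends

  Vertex Edge : Set
  Vertex = Fin n
  Edge   = Fin m

  src tgt : Edge → Vertex
  src e = proj₁ (ends e)
  tgt e = proj₂ (ends e)

  -- A subgraph on the vertex set V is given by its edge set.
  Subgraph : Set
  Subgraph = Subset m

  Rank : Set
  Rank = Vertex → ℤ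

  outEdges inEdges : Vertex → Subset m
  outEdges v = tabulate λ e → ⌊ src e Fin.≟ v ⌋
  inEdges  v = tabulate λ e → ⌊ tgt e Fin.≟ v ⌋

  Eulerian : Subgraph → Set
  Eulerian H = ∀ v → ∣ H ∩ inEdges v ∣ ≡ ∣ H ∩ outEdges v ∣

  MaximalEulerian : Subgraph → Set
  MaximalEulerian H = Eulerian H × (∀ H′ → Eulerian H′ → ¬ (H ⊂ H′))

  Backward : Rank → Edge → Set
  Backward r e = r (tgt e) ≤ r (src e)

  Conforms : Rank → Subgraph → Set
  Conforms r H = ∀ e → Backward r e → e ∈ H

  slack : Edge → Rank → ℤ
  slack e r = (r (tgt e) - r (src e) - 1ℤ) ⊔ 0ℤ

-- The adjacency lists through which an algorithm accesses the graph, in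
-- arbitrary order.
record AdjacencyLists (G : Graph) : Set where
  open Graph G
  field
    out   : Vertex → List Edge
    inn   : Vertex → List Edge
    out-↭ : ∀ v → out v ↭ filter (λ e → src e Fin.≟ v) (allFin m)
    inn-↭ : ∀ v → inn v ↭ filter (λ e → tgt e Fin.≟ v) (allFin m)

-- c σ k a σ′ : started in the memory state σ, the computation c halts
-- after k elementary operations with result a in the state σ′.  All
-- computations below are deterministic; one that diverges is related to
-- nothing.
Com : Set → Set → Set₁
Com S A = S → ℕ → A → S → Set

private
  variable
    S A B : Set

data Charge (k : ℕ) (f : S → A × S) : Com S A where
  charge : ∀ {σ} → Charge k f σ k (proj₁ (f σ)) (proj₂ (f σ))

data _>>=_ (c : Com S A) (f : A → Com S B) : Com S B where
  bind : ∀ {σ k a σ₁ l b σ₂} →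
         c σ k a σ₁ → f a σ₁ l b σ₂ → (c >>= f) σ (k ℕ.+ l) b σ₂

infixl 1 _>>=_ _>>_

_>>_ : Com S ⊤ → Com S B → Com S B
c >> d = c >>= λ _ → d

data While (cond : Com S Bool) (body : Com S ⊤) : Com S ⊤ where
  stop : ∀ {σ k σ₁} →
         cond σ k false σ₁ → While cond body σ k tt σ₁
  next : ∀ {σ k σ₁ l σ₂ j σ₃} →
         cond σ k true σ₁ → body σ₁ l tt σ₂ → While cond body σ₂ j tt σ₃ →
         While cond body σ (k ℕ.+ l ℕ.+ j) tt σ₃

read : (S → A) → Com S A
read f = Charge 1 (λ σ → f σ , σ)

modify : (S → S) → Com S ⊤
modify f = Charge 1 (λ σ → tt , f σ)

skip : Com S ⊤
skip = modify id

when : Bool → Com S ⊤ → Com S ⊤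
when b c = if b then c else skip

forEach : List A → (A → Com S ⊤) → Com S ⊤
forEach []       f = skip
forEach (x ∷ xs) f = do
  skip
  f x
  forEach xs f

-- A unit-cost random access machine, on which priority queues are to be
-- implemented.

-- A store consists of arrays, named by natural numbers, of integers.
Store : Set
Store = ℕ → ℤ → ℤ

_[_,_↦_] : Store → ℕ → ℤ → ℤ → Store
(σ [ a , i ↦ x ]) b j = if (b ≡ᵇ a) ∧ ⌊ j ℤ.≟ i ⌋ then x else σ b j

infixl 6 _⊕_ _⊖_

data Exp : Set where
  lit     : ℤ → Exp
  cell    : ℕ → Exp → Exp
  _⊕_ _⊖_ : Exp → Exp → Exp

eval : Exp → Store → ℤ
eval (lit x)    σ = x
eval (cell a i) σ = σ a (eval i σ)
eval (d ⊕ e)    σ = eval d σ + eval e σ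
eval (d ⊖ e)    σ = eval d σ - eval e σ

-- The number of elementary operations in the evaluation.
size : Exp → ℕ
size (lit x)    = 1
size (cell a i) = suc (size i)
size (d ⊕ e)    = suc (size d ℕ.+ size e)
size (d ⊖ e)    = suc (size d ℕ.+ size e)

infixr 4 _⨾_

data Cmd : Set where
  set    : ℕ → Exp → Exp → Cmd        -- set a i e  is  a[i] := e
  _⨾_    : Cmd → Cmd → Cmd
  if≤    : Exp → Exp → Cmd → Cmd → Cmd
  while≤ : Exp → Exp → Cmd → Cmd

compare : Exp → Exp → Com Store Bool
compare d e =
  Charge (suc (size d ℕ.+ size e)) λ σ → ⌊ eval d σ ℤ.≤? eval e σ ⌋ , σ

⟦_⟧ : Cmd → Com Store ⊤
⟦ set a i e ⟧      = Charge (suc (size i ℕ.+ size e))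
                       λ σ → tt , σ [ a , eval i σ ↦ eval e σ ]
⟦ c ⨾ d ⟧          = ⟦ c ⟧ >> ⟦ d ⟧
⟦ if≤ d e c₁ c₂ ⟧  = compare d e >>= λ b → if b then ⟦ c₁ ⟧ else ⟦ c₂ ⟧
⟦ while≤ d e c ⟧   = While (compare d e) ⟦ c ⟧

-- Calling convention: a procedure finds its arguments in cell 0 of the
-- arrays 0 and 1, and leaves its result in cell 0 of the array 2.
call : Cmd → ℤ → ℤ → Com Store ℤ
call c x y = do
  modify λ σ → σ [ 0 , 0ℤ ↦ x ]
  modify λ σ → σ [ 1 , 0ℤ ↦ y ]
  ⟦ c ⟧
  read λ σ → σ 2 0ℤ

-- Content of a queue with keys in Fin n: the priority of each key that
-- is present.
Content : ℕ → Set
Content n = Fin n → Maybe ℕ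

-- Correct implementations of queues served largest priority first.
-- Nothing is required of the running times of the single operations:
-- they enter the running time of the algorithm that uses the queue.  The
-- store is arbitrary before `init`.
record PriorityQueue : Set₁ where
  field
    init isEmpty insert popMax : Cmd

    Represents : ∀ n → Content n → Store → Set

    init-correct : ∀ n σ →
      ∃[ k ] ∃[ z ] ∃[ σ′ ] call init (+ n) 0ℤ σ k z σ′
        × Represents n (const nothing) σ′

    isEmpty-correct : ∀ {n} {Q : Content n} {σ} → Represents n Q σ →
      ∃[ k ] ∃[ z ] ∃[ σ′ ] call isEmpty 0ℤ 0ℤ σ k z σ′
        × (z ≡ 1ℤ ⇔ (∀ v → Q v ≡ nothing))
        × Represents n Q σ′

    -- If the key is already present, its priority is replaced.
    insert-correct : ∀ {n} {Q : Content n} {σ} → Represents n Q σ →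
      ∀ v x →
      ∃[ k ] ∃[ z ] ∃[ σ′ ] call insert (+ toℕ v) (+ x) σ k z σ′
        × Represents n (updateAt Q v (const (just x))) σ′

    popMax-correct : ∀ {n} {Q : Content n} {σ} → Represents n Q σ →
      ¬ (∀ v → Q v ≡ nothing) →
      ∃[ k ] ∃[ v ] ∃[ x ] ∃[ σ′ ] call popMax 0ℤ 0ℤ σ k (+ toℕ v) σ′
        × Q v ≡ just x
        × (∀ w y → Q w ≡ just y → y ℕ.≤ x)
        × Represents n (updateAt Q v (const nothing)) σ′

-- The algorithm Relief(H, r, G, p, s), where (p, s) is the edge pₛ.
-- Every `read` and `modify` performs a bounded number of elementary
-- operations and accesses to single array cells, and is charged 1.

module _ (PQ : PriorityQueue) (G : Graph) (L : AdjacencyLists G) where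
  open PriorityQueue PQ
  open Graph G
  open AdjacencyLists L

  record State : Set where
    field
      F      : Subset m
      r′     : Rank
      t      : Vertex → ℤ
      parent : Vertex → Vertex
      via    : Vertex → Edge     -- the edge joining x and parent x
      O      : Subset m
      x      : Vertex            -- current vertex on the path
      queue  : Store
  open State

  data OnQueue (c : Com Store A) : Com State A where
    onQueue : ∀ {σ k a q} →
              c (queue σ) k a q → OnQueue c σ k a (record σ { queue = q })

  -- Reading the number of a vertex as that vertex.
  data AsVertex : ℤ → Com State Vertex where
    asVertex : ∀ {v σ} → AsVertex (+ toℕ v) σ 0 v σ

  nonEmpty : Com State Bool
  nonEmpty = do
    z ← OnQueue (call isEmpty 0ℤ 0ℤ)
    read λ _ → not ⌊ z ℤ.≟ 1ℤ ⌋

  pop : Com State Vertex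
  pop = OnQueue (call popMax 0ℤ 0ℤ) >>= AsVertex

  add : Vertex → ℤ → Com State ⊤
  add v τ = OnQueue (call insert (+ toℕ v) τ) >>= λ _ → skip

  -- Vertex v is offered priority τ from u, while edge e is processed.
  offer : Vertex → Vertex → Edge → ℤ → Com State ⊤
  offer u v e τ = do
    larger ← read λ σ → ⌊ t σ v ℤ.<? τ ⌋
    when larger do
      modify λ σ → record σ { t = updateAt (t σ) v (const τ) }
      add v τ
      modify λ σ → record σ { parent = updateAt (parent σ) v (const u) }
      modify λ σ → record σ { via = updateAt (via σ) v (const e) }

  scanOut : Vertex → Edge → Com State ⊤
  scanOut u e = do
    b ← read λ σ → not (lookup (F σ) e) ∧ ⌊ r′ σ (tgt e) ℤ.≤? r′ σ u ⌋
    when b do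
      τ ← read λ σ → r′ σ u + 1ℤ - r′ σ (tgt e)
      offer u (tgt e) e τ

  scanIn : Rank → Vertex → Edge → Com State ⊤
  scanIn r u e = do
    b ← read λ σ → lookup (F σ) e ∧ ⌊ slack e r ℤ.<? slack e (r′ σ) ⌋
    when b do
      τ ← read λ σ → slack e (r′ σ) - slack e r
      offer u (src e) e τ

  initialize : Subgraph → Rank → Edge → Com State ⊤
  initialize H r pₛ = do
    forEach (allFin m) λ e →
      modify λ σ → record σ { F = F σ [ e ]≔ lookup H e }
    forEach (allFin n) λ v → do
      modify λ σ → record σ { r′ = updateAt (r′ σ) v (const (r v)) }
      modify λ σ → record σ { t = updateAt (t σ) v (const 0ℤ) }
    τ ← read λ _ → r s - r p - 1ℤ
    modify λ σ → record σ { t = updateAt (t σ) p (const τ) }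
    _ ← OnQueue (call init (+ n) 0ℤ)
    add p τ
    where
    p = src pₛ
    s = tgt pₛ

  mainLoop : Rank → Com State ⊤
  mainLoop r = While nonEmpty do
    u ← pop
    modify λ σ → record σ { r′ = updateAt (r′ σ) u (_+ t σ u) }
    forEach (out u) (scanOut u)
    forEach (inn u) (scanIn r u)

  augment : Edge → Com State ⊤
  augment pₛ = do
    forEach (allFin m) λ e →
      modify λ σ → record σ { O = O σ [ e ]≔ false }
    modify λ σ → record σ { x = s }
    While (read λ σ → not ⌊ x σ Fin.≟ p ⌋) do
      modify λ σ → record σ { O = O σ [ via σ (x σ) ]≔ true }
      modify λ σ → record σ { x = parent σ (x σ) }
    forEach (allFin m) λ e →
      modify λ σ → record σ { F = F σ [ e ]≔ (lookup (F σ) e xor lookup (O σ) e) }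
    modify λ σ → record σ { F = F σ [ pₛ ]≔ false }
    where
    p = src pₛ
    s = tgt pₛ

  -- H′ and r′ are returned in the fields F and r′ of the final state.
  relief : Subgraph → Rank → Edge → Com State ⊤
  relief H r pₛ = do
    initialize H r pₛ
    mainLoop r
    positive ← read λ σ → ⌊ 0ℤ ℤ.<? slack pₛ (r′ σ) ⌋
    when positive (augment pₛ)

{-# OPTIONS --safe #-}
-- Priorities offered by the vertex removed last, which had priority b, are at
-- most b: outside H, which contains the backward edges, v exceeds u by at
-- least 1 in rank, and the slack of an edge entering u grows by at most b.
-- A vertex v removed earlier was raised by t(v) ≥ b, so it receives no offer.
-- Hence every vertex is removed, and every edge scanned, at most once in each
-- direction, and the maximal priority never increases.  A bucket queue with a
-- pointer to the top bucket thus takes O(n + m + slack) in total: the pointer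
-- climbs to slack((p, s), r) on the first insertion and only descends
-- afterwards.  The parent of a vertex is removed before it, so the path
-- followed by the augmentation has fewer than n edges; it exists, because the
-- slack of (p, s) is positive in the end only if s has been removed.
module Submission where

open import Defs
open import Data.Bool.Base using (Bool; true; false; if_then_else_; not)
open import Data.Bool.Properties using (∧-conicalˡ; ∧-conicalʳ; not-injective)
open import Data.Fin.Base using (Fin; zero; suc; toℕ)
import Data.Fin.Properties as Fin
open import Data.Fin.Subset using (Subset)
open import Data.Integer.Base using (ℤ; +_; -[1+_]; 0ℤ; 1ℤ; -1ℤ; +≤+; +<+)
import Data.Integer.Base as ℤ
import Data.Integer.Properties as ℤ
import Data.Integer.Tactic.RingSolver as ℤSolver
open import Data.List.Base using (List; []; _∷_; length; filter; allFin)
open import Data.List.Membership.Propositional.Properties using (∈-allFin)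
open import Data.List.Properties using (length-tabulate)
open import Data.List.Relation.Binary.Permutation.Propositional using (↭-sym)
open import Data.List.Relation.Binary.Permutation.Propositional.Properties using (↭-length; All-resp-↭)
open import Data.List.Relation.Unary.All using (All; []; _∷_)
open import Data.List.Relation.Unary.All.Properties using (all-filter)
open import Data.List.Relation.Unary.Any using (here; there)
open import Data.Maybe.Base using (Maybe; just; nothing; maybe)
import Data.Nat.Base as ℕ
open import Data.Nat.Base using (zero; suc; z≤n; s≤s)
open import Data.Nat.Induction using (Acc; acc; <-wellFounded)
import Data.Nat.Properties as ℕ
open import Data.Nat.Tactic.RingSolver using (solve-∀)
open import Algebra.Properties.CommutativeMonoid.Sum ℕ.+-0-commutativeMonoid using (sum; sum-cong-≗)
open import Algebra.Properties.CommutativeSemigroup ℕ.+-commutativeSemigroup using (x∙yz≈y∙xz)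
open import Data.Product.Base using (proj₁; proj₂; _,_)
open import Data.Sum.Base using (_⊎_; inj₁; inj₂; map₂)
open import Data.Unit.Base using (⊤)
open import Data.Vec.Base using (lookup; _[_]≔_)
open import Data.Vec.Functional using (updateAt)
open import Data.Vec.Functional.Properties using (updateAt-updates; updateAt-minimal)
open import Data.Vec.Properties using ([]=⇒lookup; lookup∘update; lookup∘update′)
open import Function.Base using (const; id)
open import Function.Bundles using (_⇔_; mk⇔)
open import Relation.Binary.PropositionalEquality
open import Relation.Nullary using (Dec; yes; no; ¬_; contradiction)
open import Relation.Nullary.Decidable.Core using (⌊_⌋)
open import Data.Nat as ℕ using (ℕ)
open import Data.Product using (_×_; Σ-syntax; ∃-syntax)
open import Data.Unit using (tt)

-- A `Com` is only a relation, so halting, result and running time have to be proved together;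
-- credits are fuel for termination and time bound at once. No useful bound holds for a single queue
-- operation, since one search for the top may discard many nodes. The analysis therefore works with
-- the bucket queue itself instead of the interface and threads its potential through the whole run.
-- Two obstacles shape the queue. The store is arbitrary at the start and `init` does not know the
-- largest priority, so a bucket is cleared only when `top` climbs onto it. And a vertex may be
-- offered a priority in many edge scans; finding its old node in a linked list would be expensive,
-- so the old node stays and has prepaid its own disposal. Parent links may be overwritten while a
-- vertex waits. The removal order `ord`, which the program does not store, shows that following
-- them terminates. Constants are counted from `size` and rounded up.

-- Amortised cost as a program logic.

module Credits where
  open import Data.Nat.Base using (_+_; _*_; _≤_; _<_)

  private
    variable
      S A B : Set

  -- With N credits, c started in σ halts, spending one credit per elementary
  -- operation; P is satisfied by the number of credits left, the result and
  -- the final state.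
  record Run (c : Com S A) (σ : S) (N : ℕ) (P : ℕ → A → S → Set) : Set where
    constructor run
    field
      {time}     : ℕ
      {result}   : A
      {final}    : S
      {credits}  : ℕ
      halts      : c σ time result final
      affordable : time + credits ≤ N
      post       : P credits result final

  private
    variable
      c : Com S A
      σ : S
      N N′ k : ℕ
      P P′ : ℕ → A → S → Set

  mono : (∀ {j a σ} → P j a σ → P′ j a σ) → Run c σ N P → Run c σ N P′
  mono f (run h l p) = run h l (f p)

  weaken : N ≤ N′ → Run c σ N P → Run c σ N′ P
  weaken N≤N′ (run h l p) = run h (ℕ.≤-trans l N≤N′) p

  pay : ∀ {f : S → A × S} → P N (proj₁ (f σ)) (proj₂ (f σ)) →
        Run (Charge k f) σ (k + N) P
  pay p = run charge ℕ.≤-refl p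

  chain : ∀ {f : A → Com S B} →
          Run c σ N (λ j a σ′ → Run (f a) σ′ j P) → Run (c >>= f) σ N P
  chain {N = N} (run {k} {credits = i} h l (run {k′} {credits = j} h′ l′ p)) =
    run (bind h h′) (begin
      k + k′ + j    ≡⟨ ℕ.+-assoc k k′ j ⟩
      k + (k′ + j)  ≤⟨ ℕ.+-monoʳ-≤ k l′ ⟩
      k + i         ≤⟨ l ⟩
      N             ∎) p
    where open ℕ.≤-Reasoning

  payThen : ∀ {g : S → A × S} {f : A → Com S B} →
            Run (f (proj₁ (g σ))) (proj₂ (g σ)) N P →
            Run (Charge k g >>= f) σ (k + N) P
  payThen r = chain (pay r)

  -- The frame rule: the execution paid for by `N` credits is unchanged when `M` more are carried
  -- along untouched. A caller thus keeps credits for what comes after `c`.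
  frame : ∀ M → Run c σ N P → Run c σ (M + N) λ j a σ → ∃[ i ] j ≡ M + i × P i a σ
  frame {N = N} M (run {k} {credits = j} h l p) = run h (begin
    k + (M + j)  ≡⟨ ℕ.+-assoc k M j ⟨
    k + M + j    ≡⟨ cong (λ z → z + j) (ℕ.+-comm k M) ⟩
    M + k + j    ≡⟨ ℕ.+-assoc M k j ⟩
    M + (k + j)  ≤⟨ ℕ.+-monoʳ-≤ M l ⟩
    M + N        ∎) (j , refl , p)
    where open ℕ.≤-Reasoning

  -- Postcondition of a loop test. On `true` it already contains the run of the body, so that what
  -- the test established is available there.
  Branch : Com S ⊤ → (ℕ → S → Set) → (ℕ → ⊤ → S → Set) → ℕ → Bool → S → Set
  Branch body I P i true  σ = Run body σ i λ j _ σ → I j σ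
  Branch body I P i false σ = P i tt σ

  -- No separate measure is needed: every round loses at least one credit.
  payWhile : ∀ {cond : Com S Bool} {body : Com S ⊤} {P : ℕ → ⊤ → S → Set}
             (I : ℕ → S → Set) →
             (∀ {j σ} → I j σ → ∃[ i ] i < j ×
               Run cond σ i (Branch body I P)) →
             I N σ → Run (While cond body) σ N P
  payWhile {S} {cond = cond} {body} {P} I step = go (<-wellFounded _)
    where
    go : ∀ {N σ} → Acc _<_ N → I N σ → Run (While cond body) σ N P
    go {N} (acc rs) x with step x
    ... | i , i<N , run {k} {false} {credits = j} h l p =
      run (stop h) (ℕ.≤-trans l (ℕ.<⇒≤ i<N)) p
    ... | i , i<N , run {k} {true} {credits = j} h l (run {k′} {credits = j′} h′ l′ x′) =
      let
        j′<N = ℕ.≤-<-trans (ℕ.≤-trans (ℕ.m≤n+m j′ k′) l′)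
                 (ℕ.≤-<-trans (ℕ.≤-trans (ℕ.m≤n+m j k) l) i<N)
        run {k″} {credits = j″} h″ l″ p = go (rs j′<N) x′
      in run (next h h′ h″) (begin
        k + k′ + k″ + j″    ≡⟨ ℕ.+-assoc (k + k′) k″ j″ ⟩
        k + k′ + (k″ + j″)  ≤⟨ ℕ.+-monoʳ-≤ (k + k′) l″ ⟩
        k + k′ + j′         ≡⟨ ℕ.+-assoc k k′ j′ ⟩
        k + (k′ + j′)       ≤⟨ ℕ.+-monoʳ-≤ k l′ ⟩
        k + j               ≤⟨ l ⟩
        i                   ≤⟨ ℕ.<⇒≤ i<N ⟩
        N                   ∎) p
      where open ℕ.≤-Reasoning

  -- The credits of the remaining iterations are framed past the current one, so `I` sees only the
  -- surplus `N`. The extra 1 per element and at the end pays for the `skip`s of `forEach`.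
  payForEach : ∀ {f : A → Com S ⊤} {P : ℕ → ⊤ → S → Set} (I : List A → ℕ → S → Set) b →
               (∀ {x xs j σ} → I (x ∷ xs) j σ → Run (f x) σ (b + j) λ j _ σ → I xs j σ) →
               (∀ {j σ} → I [] j σ → P j tt σ) →
               ∀ xs → I xs N σ → Run (forEach xs f) σ (suc (length xs * suc b) + N) P
  payForEach I b step end [] x = pay (end x)
  payForEach {N = N} I b step end (y ∷ xs) x =
    payThen (chain (weaken (ℕ.≤-reflexive eq)
      (mono (λ { (i , refl , z) → payForEach I b step end xs z }) (frame M (step x)))))
    where
    M = suc (length xs * suc b)
    eq : M + (b + N) ≡ suc (b + length xs * suc b) + N
    eq = begin
      M + (b + N)                       ≡⟨ ℕ.+-assoc M b N ⟨
      M + b + N                         ≡⟨ cong (λ z → z + N) (ℕ.+-comm M b) ⟩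
      b + M + N                         ≡⟨ cong (λ z → z + N) (ℕ.+-suc b _) ⟩
      suc (b + length xs * suc b) + N   ∎
      where open ≡-Reasoning

  payCompare : ∀ d e {σ} {P : ℕ → Bool → Store → Set} →
               (eval d σ ℤ.≤ eval e σ → P N true σ) →
               (eval e σ ℤ.< eval d σ → P N false σ) →
               Run (compare d e) σ (suc (size d + size e) + N) P
  payCompare d e {σ} {P} yes! no! = pay go
    where
    go : P _ ⌊ eval d σ ℤ.≤? eval e σ ⌋ σ
    go with eval d σ ℤ.≤? eval e σ
    ... | yes d≤e = yes! d≤e
    ... | no  d≰e = no! (ℤ.≰⇒> d≰e)

open Credits

-- A bucket queue with lazy deletion.

module BucketQueue where
  open import Data.Nat.Base using (_+_; _*_; _∸_; _≤_; _<_)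
  open import Data.List.Membership.Propositional using (_∈_)

  -- Bucket i is a linked list whose first node is head[i], where 0 stands for
  -- no node.  Nodes are never changed nor reused, so the lists need not be kept
  -- apart.  A node is stale, and is discarded when it is met, if its key has
  -- left the queue or has been given another priority; prio[v] is -1 if v is
  -- absent.  As no bucket above top is in use, a node with key v in the bucket
  -- top is stale if and only if prio[v] < top.
  prio head key link : Exp → Exp
  prio = cell 3
  head = cell 4
  key  = cell 5
  link = cell 6

  zeroE oneE free top flag arg₀ arg₁ : Exp
  zeroE = lit 0ℤ
  oneE = lit 1ℤ
  free = cell 7 zeroE
  top  = cell 8 zeroE
  flag = cell 2 zeroE
  arg₀ = cell 0 zeroE
  arg₁ = cell 1 zeroE

  -- normalise leaves in flag 1 if the queue is empty, and 2 if the first node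
  -- of the bucket top is not stale.
  clear normalise take grow push init popMax insert : Cmd
  clear = while≤ oneE arg₀
    (set 0 zeroE (arg₀ ⊖ oneE) ⨾
     set 3 arg₀ (lit -1ℤ))
  normalise =
    set 2 zeroE zeroE ⨾
    while≤ flag zeroE
      (if≤ (head top) zeroE
        (if≤ top zeroE
          (set 2 zeroE oneE)
          (set 8 zeroE (top ⊖ oneE)))
        (if≤ top (prio (key (head top)))
          (set 2 zeroE (lit (+ 2)))
          (set 4 top (link (head top)))))
  take =
    set 2 zeroE (key (head top)) ⨾
    set 3 flag (lit -1ℤ)
  grow = while≤ (top ⊕ oneE) arg₁
    (set 8 zeroE (top ⊕ oneE) ⨾
     set 4 top zeroE)
  push =
    set 5 free arg₀ ⨾
    set 6 free (head arg₁) ⨾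
    set 4 arg₁ free ⨾
    set 7 zeroE (free ⊕ oneE) ⨾
    set 3 arg₀ arg₁
  init =
    clear ⨾
    set 8 zeroE zeroE ⨾
    set 4 zeroE zeroE ⨾
    set 7 zeroE oneE
  popMax = normalise ⨾ take
  insert = grow ⨾ push

  -- The list starting at the node c has the keys l, its nodes being among 1, …, f.
  Chain : ∀ {n} → (ℤ → ℤ) → (ℤ → ℤ) → ℕ → ℤ → List (Fin n) → Set
  Chain κ ν f c []      = c ≡ 0ℤ
  Chain κ ν f c (v ∷ l) =
    ∃[ i ] i < f × c ≡ + suc i × κ c ≡ + toℕ v × Chain κ ν f (ν c) l

  encode : Maybe ℕ → ℤ
  encode = maybe +_ -1ℤ

  Buckets : ℕ → Set
  Buckets n = ℕ → List (Fin n)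

  private
    variable
      n : ℕ

  _[_≔_] : Buckets n → ℕ → List (Fin n) → Buckets n
  (B [ i ≔ l ]) j = if ⌊ j ℕ.≟ i ⌋ then l else B j

  total : Buckets n → ℕ → ℕ
  total B zero    = length (B zero)
  total B (suc c) = length (B (suc c)) + total B c

  -- Every round of normalise decreases the potential, except the last one.
  potential : Buckets n → ℕ → ℕ
  potential B c = c + total B c

  -- A store representing Q still does so when the arrays 0, 1 and 2 change:
  -- no field mentions them, so record { Rep R } retypes R : Rep n Q cur B σ.
  record Rep (n : ℕ) (Q : Content n) (cur : ℕ) (B : Buckets n) (σ : Store) : Set where
    field
      nodes  : ℕ
      top-≡  : σ 8 0ℤ ≡ + cur
      free-≡ : σ 7 0ℤ ≡ + suc nodes
      chains : ∀ i → i ≤ cur → Chain (σ 5) (σ 6) nodes (σ 4 (+ i)) (B i)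
      above  : ∀ i → cur < i → B i ≡ []
      prio-≡ : ∀ v → σ 3 (+ toℕ v) ≡ encode (Q v)
      live   : ∀ v x → Q v ≡ just x → v ∈ B x

    bounded : ∀ v x → Q v ≡ just x → x ≤ cur
    bounded v x eq with x ℕ.≤? cur
    ... | yes x≤cur = x≤cur
    ... | no  x≰cur with B x | above x (ℕ.≰⇒> x≰cur) | live v x eq
    ...   | _ | refl | ()

  -- Array names are numerals, so in an updated store the test of the name computes away; only the
  -- comparison of indices is left to this lemma and the next.
  ≟-refl : ∀ {A : Set} {x y : A} i → (if ⌊ i ℤ.≟ i ⌋ then x else y) ≡ x
  ≟-refl i with i ℤ.≟ i
  ... | yes _ = refl
  ... | no i≢i = contradiction refl i≢i

  ≟-≢ : ∀ {A : Set} {x y : A} {i j} → i ≢ j → (if ⌊ i ℤ.≟ j ⌋ then x else y) ≡ y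
  ≟-≢ {i = i} {j} i≢j with i ℤ.≟ j
  ... | yes eq = contradiction eq i≢j
  ... | no _ = refl

  ≔-same : ∀ (B : Buckets n) i {l} → (B [ i ≔ l ]) i ≡ l
  ≔-same B i with i ℕ.≟ i
  ... | yes _ = refl
  ... | no i≢i = contradiction refl i≢i

  ≔-other : ∀ (B : Buckets n) {i j l} → j ≢ i → (B [ i ≔ l ]) j ≡ B j
  ≔-other B {i} {j} j≢i with j ℕ.≟ i
  ... | yes eq = contradiction eq j≢i
  ... | no _ = refl

  total-≔-above : ∀ (B : Buckets n) {i l} c → c < i → total (B [ i ≔ l ]) c ≡ total B c
  total-≔-above B zero    c<i = cong length (≔-other B (ℕ.<⇒≢ c<i))
  total-≔-above B (suc c) c<i =
    cong₂ _+_ (cong length (≔-other B (ℕ.<⇒≢ c<i))) (total-≔-above B c (ℕ.<-trans (ℕ.n<1+n c) c<i))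

  total-≔ : ∀ (B : Buckets n) {i l} c → i ≤ c →
            length (B i) + total (B [ i ≔ l ]) c ≡ length l + total B c
  total-≔ B {l = l} zero z≤n = ℕ.+-comm _ (length l)
  total-≔ B {i} {l} (suc c) i≤c with suc c ℕ.≟ i
  ... | yes refl = trans (x∙yz≈y∙xz (length (B i)) (length l) _)
                     (cong (λ z → length l + (length (B i) + z)) (total-≔-above B c ℕ.≤-refl))
  ... | no c≢i = trans (x∙yz≈y∙xz (length (B i)) (length (B (suc c))) _)
                   (trans (cong (λ z → length (B (suc c)) + z)
                     (total-≔ B c (ℕ.≤-pred (ℕ.≤∧≢⇒< i≤c (λ eq → c≢i (sym eq))))))
                     (x∙yz≈y∙xz (length (B (suc c))) (length l) _))

  -- Lets all buckets share two arrays: an allocation writes `key` and `link` only at a new node,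
  -- outside the range of the old lists.
  Chain-extend : ∀ {κ κ′ ν ν′ : ℤ → ℤ} {f f′ c} (l : List (Fin n)) → f ≤ f′ →
                 (∀ i → i < f → κ′ (+ suc i) ≡ κ (+ suc i)) →
                 (∀ i → i < f → ν′ (+ suc i) ≡ ν (+ suc i)) →
                 Chain κ ν f c l → Chain κ′ ν′ f′ c l
  Chain-extend [] f≤ k= n= ch = ch
  Chain-extend {κ′ = κ′} {ν′ = ν′} {f′ = f′} (v ∷ l) f≤ k= n= (i , i<f , refl , key= , ch) =
    i , ℕ.≤-trans i<f f≤ , refl , trans (k= i i<f) key= ,
    subst (λ c → Chain κ′ ν′ f′ c l) (sym (n= i i<f)) (Chain-extend l f≤ k= n= ch)

  -- Effects of single steps on the representation.

  module _ {n : ℕ} {Q : Content n} where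

    dropStale : ∀ {cur B σ p v l} → p ≡ + cur → Rep n Q cur B σ →
                B cur ≡ v ∷ l → Q v ≢ just cur →
                Rep n Q cur (B [ cur ≔ l ]) (σ [ 4 , p ↦ σ 6 (σ 4 p) ])
    dropStale {cur} {B} {σ} {p} {v} {l} refl R eq stale = record
      { nodes  = nodes
      ; top-≡  = top-≡
      ; free-≡ = free-≡
      ; chains = chains′
      ; above  = λ i cur<i → trans (≔-other B (ℕ.>⇒≢ cur<i)) (above i cur<i)
      ; prio-≡ = prio-≡
      ; live   = live′
      }
      where
      open Rep R
      chains′ : ∀ i → i ≤ cur →
        Chain (σ 5) (σ 6) nodes ((σ [ 4 , p ↦ σ 6 (σ 4 p) ]) 4 (+ i)) ((B [ cur ≔ l ]) i)
      chains′ i i≤cur with i ℕ.≟ cur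
      ... | yes refl =
        let _ , _ , _ , _ , ch = subst (Chain (σ 5) (σ 6) nodes (σ 4 p)) eq (chains i i≤cur) in ch
      ... | no i≢cur = chains i i≤cur
      live′ : ∀ w x → Q w ≡ just x → w ∈ (B [ cur ≔ l ]) x
      live′ w x e with x ℕ.≟ cur
      ... | no _ = live w x e
      -- If the dropped node were the one that `live` found for `w`, then `w` would have priority
      -- `cur`, against `stale`.
      ... | yes refl with subst (w ∈_) eq (live w x e)
      ...   | here refl = contradiction e stale
      ...   | there w∈l = w∈l

    descend : ∀ {cur B σ p} → p ≡ + cur → Rep n Q (suc cur) B σ → B (suc cur) ≡ [] →
              Rep n Q cur B (σ [ 8 , 0ℤ ↦ p ])
    descend {cur} {B} refl R eq = record
      { nodes  = nodes
      ; top-≡  = refl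
      ; free-≡ = free-≡
      ; chains = λ i i≤cur → chains i (ℕ.m≤n⇒m≤1+n i≤cur)
      ; above  = above′
      ; prio-≡ = prio-≡
      ; live   = live
      }
      where
      open Rep R
      above′ : ∀ i → cur < i → B i ≡ []
      above′ i cur<i with i ℕ.≟ suc cur
      ... | yes refl = eq
      ... | no  i≢   = above i (ℕ.≤∧≢⇒< cur<i (λ e → i≢ (sym e)))

    -- Cells of `head` above `top` are unconstrained, because the store was arbitrary before `init`.
    -- Writing 0 makes the cell agree with the empty bucket that `above` promises.
    ascend : ∀ {cur B σ p} → p ≡ + suc cur → Rep n Q cur B σ →
             Rep n Q (suc cur) B (σ [ 8 , 0ℤ ↦ p ] [ 4 , p ↦ 0ℤ ])
    ascend {cur} {B} {σ} {p} refl R = record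
      { nodes  = nodes
      ; top-≡  = refl
      ; free-≡ = free-≡
      ; chains = chains′
      ; above  = λ i cur<i → above i (ℕ.<-trans (ℕ.n<1+n cur) cur<i)
      ; prio-≡ = prio-≡
      ; live   = live
      }
      where
      open Rep R
      chains′ : ∀ i → i ≤ suc cur →
        Chain (σ 5) (σ 6) nodes ((σ [ 4 , p ↦ 0ℤ ]) 4 (+ i)) (B i)
      chains′ i i≤cur with i ℕ.≟ suc cur
      ... | yes refl rewrite above i ℕ.≤-refl = refl
      ... | no  i≢ = chains i (ℕ.≤-pred (ℕ.≤∧≢⇒< i≤cur i≢))

    -- The node of `v` stays in its bucket: `live` demands nodes for present keys and tolerates any
    -- others.
    delete : ∀ {cur B σ p} → Rep n Q cur B σ → ∀ v → p ≡ + toℕ v →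
             Rep n (updateAt Q v (const nothing)) cur B (σ [ 3 , p ↦ -1ℤ ])
    delete {cur} {B} {σ} R v refl = record
      { nodes  = nodes
      ; top-≡  = top-≡
      ; free-≡ = free-≡
      ; chains = chains
      ; above  = above
      ; prio-≡ = prio′
      ; live   = live′
      }
      where
      open Rep R
      prio′ : ∀ w → (σ [ 3 , + toℕ v ↦ -1ℤ ]) 3 (+ toℕ w) ≡ encode (updateAt Q v (const nothing) w)
      prio′ w with w Fin.≟ v
      ... | yes refl = trans (≟-refl (+ toℕ w)) (sym (cong encode (updateAt-updates w Q)))
      ... | no w≢v = trans (≟-≢ (λ e → w≢v (Fin.toℕ-injective (ℤ.+-injective e))))
                       (trans (prio-≡ w) (sym (cong encode (updateAt-minimal w v Q w≢v))))
      live′ : ∀ w x → updateAt Q v (const nothing) w ≡ just x → w ∈ B x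
      live′ w x e with w Fin.≟ v
      ... | yes refl with trans (sym e) (updateAt-updates w Q)
      ...   | ()
      live′ w x e | no w≢v = live w x (trans (sym (updateAt-minimal w v Q w≢v)) e)

    -- If `v` was present, its old node is left behind. It is now stale, or a duplicate in bucket
    -- `x`, which does no harm: removing `v` makes both stale.
    pushed : ∀ {cur B σ p q} → Rep n Q cur B σ → ∀ v x → x ≤ cur →
             p ≡ + toℕ v → q ≡ + x → ∀ {g h} → g ≡ σ 7 0ℤ → h ≡ σ 7 0ℤ ℤ.+ 1ℤ →
             Rep n (updateAt Q v (const (just x))) cur (B [ x ≔ v ∷ B x ])
               (σ [ 5 , g ↦ p ] [ 6 , g ↦ σ 4 q ] [ 4 , q ↦ g ]
                  [ 7 , 0ℤ ↦ h ] [ 3 , p ↦ q ])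
    pushed {cur} {B} {σ} {p} {q} R v x x≤cur refl refl {g} {h} refl refl = record
      { nodes  = suc nodes
      ; top-≡  = top-≡
      ; free-≡ = trans (cong (ℤ._+ 1ℤ) free-≡) (cong (λ z → + suc z) (ℕ.+-comm nodes 1))
      ; chains = chains′
      ; above  = λ i cur<i → trans (≔-other B (ℕ.>⇒≢ (ℕ.≤-<-trans x≤cur cur<i))) (above i cur<i)
      ; prio-≡ = prio′
      ; live   = live′
      }
      where
      open Rep R
      Q′ = updateAt Q v (const (just x))
      σ′ : Store
      σ′ = σ [ 5 , g ↦ p ] [ 6 , g ↦ σ 4 q ] [ 4 , q ↦ g ] [ 7 , 0ℤ ↦ h ] [ 3 , p ↦ q ]
      fresh : ∀ i → i < nodes → + suc i ≢ g
      fresh i i<nodes e = ℕ.<⇒≢ i<nodes (ℕ.suc-injective (ℤ.+-injective (trans e free-≡)))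
      old : ∀ {c} l → Chain (σ 5) (σ 6) nodes c l → Chain (σ′ 5) (σ′ 6) (suc nodes) c l
      old l = Chain-extend l (ℕ.n≤1+n nodes) (λ i i< → ≟-≢ (fresh i i<)) (λ i i< → ≟-≢ (fresh i i<))
      chains′ : ∀ i → i ≤ cur → Chain (σ′ 5) (σ′ 6) (suc nodes) (σ′ 4 (+ i)) ((B [ x ≔ v ∷ B x ]) i)
      chains′ i i≤cur with i ℕ.≟ x
      ... | yes refl =
        nodes , ℕ.≤-refl , free-≡ , ≟-refl g ,
        subst (λ c → Chain (σ′ 5) (σ′ 6) (suc nodes) c (B i)) (sym (≟-refl g)) (old (B i) (chains i i≤cur))
      ... | no i≢x =
        old (B i) (chains i i≤cur)
      prio′ : ∀ w → σ′ 3 (+ toℕ w) ≡ encode (Q′ w)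
      prio′ w with w Fin.≟ v
      ... | yes refl = trans (≟-refl (+ toℕ w)) (sym (cong encode (updateAt-updates w Q)))
      ... | no w≢v = trans (≟-≢ (λ e → w≢v (Fin.toℕ-injective (ℤ.+-injective e))))
                       (trans (prio-≡ w) (sym (cong encode (updateAt-minimal w v Q w≢v))))
      live′ : ∀ w y → Q′ w ≡ just y → w ∈ (B [ x ≔ v ∷ B x ]) y
      live′ w y e with w Fin.≟ v
      ... | yes refl with trans (sym e) (updateAt-updates w Q)
      ...   | refl rewrite ≔-same B x {v ∷ B x} = here refl
      live′ w y e | no w≢v with y ℕ.≟ x | live w y (trans (sym (updateAt-minimal w v Q w≢v)) e)
      ...   | yes refl | w∈ = there w∈
      ...   | no _     | w∈ = w∈

  -- Amortised costs of the queue operations.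

  -- Numerals bound the operations of loop-free code, a unit of potential is
  -- worth 30 credits, and M credits are put aside for what follows.
  module _ {n : ℕ} {Q : Content n} (cur₀ M : ℕ) where

    record Searched (j : ℕ) (σ : Store) : Set where
      field
        cur    : ℕ
        B      : Buckets n
        rep    : Rep n Q cur B σ
        cur≤   : cur ≤ cur₀
        credit : potential B cur * 30 + M ≤ j
        answer : σ 2 0ℤ ≡ 1ℤ × (∀ v → Q v ≡ nothing)
               ⊎ σ 2 0ℤ ≡ + 2 × ∃[ v ] ∃[ l ] B cur ≡ v ∷ l × Q v ≡ just cur

    -- Two states, since the flag is tested once more after the answer is found; the 5 credits pay
    -- for that test. An unsuccessful round costs at most 25 credits, less than the 30 of the unit
    -- of potential that it releases, so the 50 are restored.
    data Search (j : ℕ) (σ : Store) : Set where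
      searching : ∀ {cur B} → Rep n Q cur B σ → cur ≤ cur₀ → σ 2 0ℤ ≡ 0ℤ →
                  50 + (potential B cur * 30 + M) ≤ j → Search j σ
      searched  : ∀ {i} → Searched i σ → 5 + i ≤ j → Search j σ

    search-step : ∀ {cur B σ} → Rep n Q cur B σ → cur ≤ cur₀ → σ 2 0ℤ ≡ 0ℤ →
      Run ⟦ if≤ (head top) zeroE
              (if≤ top zeroE (set 2 zeroE oneE) (set 8 zeroE (top ⊖ oneE)))
              (if≤ top (prio (key (head top)))
                (set 2 zeroE (lit (+ 2)))
                (set 4 top (link (head top)))) ⟧
        σ (45 + (potential B cur * 30 + M)) λ j _ σ → Search j σ
    search-step {cur} {B} {σ} R cur≤ flag-≡ with B cur in eq | Rep.chains R cur ℕ.≤-refl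
    ... | [] | head-≡ = chain (payCompare (head top) zeroE
          (λ _ → exhausted cur R cur≤ eq)
          (λ 0<h → contradiction 0<h (ℤ.≤⇒≯ (ℤ.≤-reflexive (trans (cong (σ 4) top-≡) head-≡)))))
      where
      open Rep R
      exhausted : ∀ cur → Rep n Q cur B σ → cur ≤ cur₀ → B cur ≡ [] →
                  Run ⟦ if≤ top zeroE (set 2 zeroE oneE) (set 8 zeroE (top ⊖ oneE)) ⟧
                    σ (40 + (potential B cur * 30 + M)) λ j _ σ → Search j σ
      exhausted zero R cur≤ eq = chain (payCompare top zeroE
        (λ _ → pay (searched record
          { rep = record { Rep R } ; cur≤ = cur≤ ; credit = ℕ.≤-refl
          ; answer = inj₁ (refl , none) } (ℕ.m≤n+m _ 28)))
        (λ 0<t → contradiction 0<t (ℤ.≤⇒≯ (ℤ.≤-reflexive (Rep.top-≡ R)))))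
        where
        none : ∀ v → Q v ≡ nothing
        -- `bounded` forces the priority of a present key to be 0, and `live` would then put it into
        -- the empty bucket 0.
        none v with Q v in e
        ... | nothing = refl
        ... | just x with Rep.bounded R v x e | Rep.live R v x e
        ...   | z≤n | v∈ with subst (v ∈_) eq v∈
        ...     | ()
      exhausted (suc cur) R cur≤ eq =
        -- An empty bucket has no nodes, so leaving it releases exactly one unit of potential.
        weaken (ℕ.≤-reflexive released)
        (chain (payCompare top zeroE
          (λ t≤0 → contradiction (subst (ℤ._≤ 0ℤ) (Rep.top-≡ R) t≤0) (ℤ.<⇒≱ (+<+ (s≤s z≤n))))
          (λ _ → pay (searching (descend (cong (ℤ._- 1ℤ) (Rep.top-≡ R)) R eq)
                      (ℕ.<⇒≤ cur≤) flag-≡ (ℕ.m≤n+m _ 10)))))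
        where
        released : 70 + (potential B cur * 30 + M) ≡ 40 + (potential B (suc cur) * 30 + M)
        released rewrite eq = refl
    ... | v ∷ l | i , i< , head-≡ , key-≡ , _ = chain (payCompare (head top) zeroE
      (λ h≤0 → contradiction (subst (ℤ._≤ 0ℤ) head-≡′ h≤0) (ℤ.<⇒≱ (+<+ (s≤s z≤n))))
      (λ _ → chain (payCompare top (prio (key (head top)))
        (λ t≤p → pay (searched record
          { rep = record { Rep R } ; cur≤ = cur≤ ; credit = ℕ.≤-refl
          ; answer = inj₂ (refl , v , l , eq , current (subst₂ ℤ._≤_ top-≡ prio-≡′ t≤p)) }
          (ℕ.m≤n+m _ 24)))
        (λ p<t → weaken
          (ℕ.+-monoʳ-≤ 32 (ℕ.+-monoˡ-≤ M (ℕ.*-monoˡ-≤ 30 (ℕ.≤-reflexive smaller))))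
          (pay (searching (dropStale top-≡ R eq (stale (subst₂ ℤ._<_ prio-≡′ top-≡ p<t)))
                        cur≤ flag-≡ (ℕ.m≤n+m _ 5)))))))
      where
      open Rep R
      head-≡′ : σ 4 (σ 8 0ℤ) ≡ + suc i
      head-≡′ = trans (cong (σ 4) top-≡) head-≡
      prio-≡′ : σ 3 (σ 5 (σ 4 (σ 8 0ℤ))) ≡ encode (Q v)
      prio-≡′ = trans (cong (λ c → σ 3 (σ 5 (σ 4 c))) top-≡) (trans (cong (σ 3) key-≡) (prio-≡ v))
      current : + cur ℤ.≤ encode (Q v) → Q v ≡ just cur
      current cur≤Q with Q v in e
      ... | just x = cong just (ℕ.≤-antisym (bounded v x e) (ℤ.drop‿+≤+ cur≤Q))
      stale : encode (Q v) ℤ.< + cur → Q v ≢ just cur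
      stale Q<cur e = ℤ.<-irrefl refl (subst (λ q → encode q ℤ.< + cur) e Q<cur)
      smaller : suc (potential (B [ cur ≔ l ]) cur) ≡ potential B cur
      smaller = trans (sym (ℕ.+-suc cur _)) (cong (cur ℕ.+_)
        (ℕ.+-cancelˡ-≡ (length l) _ _ (begin
          length l + suc (total (B [ cur ≔ l ]) cur)  ≡⟨ ℕ.+-suc (length l) _ ⟩
          suc (length l) + total (B [ cur ≔ l ]) cur  ≡⟨ cong (λ z → length z + total (B [ cur ≔ l ]) cur) eq ⟨
          length (B cur) + total (B [ cur ≔ l ]) cur  ≡⟨ total-≔ B cur ℕ.≤-refl ⟩
          length l + total B cur                      ∎)))
        where open ≡-Reasoning

    search : ∀ {cur B σ} → Rep n Q cur B σ → cur ≤ cur₀ →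
             Run ⟦ normalise ⟧ σ (60 + (potential B cur * 30 + M)) λ j _ σ → Searched j σ
    search R cur≤ = payThen (payWhile Search step (searching (record { Rep R }) cur≤ refl (ℕ.m≤n+m _ 7)))
      where
      step : ∀ {j σ} → Search j σ → _
      step (searching R cur≤ flag-≡ credit) = _ , credit , payCompare flag zeroE
        (λ _ → search-step R cur≤ flag-≡)
        (λ 0<f → contradiction (subst (0ℤ ℤ.<_) flag-≡ 0<f) (ℤ.<-irrefl refl))
      step (searched S credit) = _ , credit , payCompare flag zeroE
        (λ f≤0 → contradiction f≤0 (ℤ.<⇒≱ (positive (Searched.answer S))))
        (λ _ → S)
        where
        positive : ∀ {x} {A B : Set} → x ≡ 1ℤ × A ⊎ x ≡ + 2 × B → 0ℤ ℤ.< x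
        positive (inj₁ (refl , _)) = +<+ (s≤s z≤n)
        positive (inj₂ (refl , _)) = +<+ (s≤s z≤n)

  module _ {n : ℕ} {Q : Content n} where

    runIsEmpty : ∀ {cur B σ} M → Rep n Q cur B σ →
                 Run (call normalise 0ℤ 0ℤ) σ (63 + (potential B cur * 30 + M))
                   λ j z σ → Searched {Q = Q} cur M j σ × z ≡ σ 2 0ℤ
    runIsEmpty {cur} {B} M R = payThen (payThen (chain (mono finish
      (frame 1 (search cur M {cur} {B} (record { Rep R }) ℕ.≤-refl)))))
      where
      finish : ∀ {j σ cur} → ∃[ i ] j ≡ 1 + i × Searched {Q = Q} cur M i σ →
               Run (read (λ σ → σ 2 0ℤ)) σ j λ j z σ → Searched {Q = Q} cur M j σ × z ≡ σ 2 0ℤ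
      finish (i , refl , S) = pay (S , refl)

    Popped : ℕ → ℕ → ℕ → ℤ → Store → Set
    Popped cur M j z σ =
      ∃[ v ] ∃[ cur′ ] ∃[ B′ ] z ≡ + toℕ v × Q v ≡ just cur′ × cur′ ≤ cur ×
        (∀ w y → Q w ≡ just y → y ≤ cur′) ×
        Rep n (updateAt Q v (const nothing)) cur′ B′ σ ×
        potential B′ cur′ * 30 + M ≤ j

    runPopMax : ∀ {cur B σ} M → Rep n Q cur B σ → ¬ (∀ v → Q v ≡ nothing) →
                Run (call popMax 0ℤ 0ℤ) σ (80 + (potential B cur * 30 + M)) (Popped cur M)
    runPopMax {cur} {B} M R some = payThen (payThen (chain (chain
      (weaken (ℕ.m≤n+m _ 3) (mono finish (frame 15 (search cur M {cur} {B} (record { Rep R }) ℕ.≤-refl)))))))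
      where
      finish : ∀ {j σ cur} → ∃[ i ] j ≡ 15 + i × Searched {Q = Q} cur M i σ →
               Run ⟦ take ⟧ σ j λ j _ σ → Run (read (λ σ → σ 2 0ℤ)) σ j (Popped cur M)
      finish (i , refl , record { answer = inj₁ (_ , none) }) = contradiction none some
      finish {σ = σ} (i , refl , record { cur = cur ; B = B ; rep = R ; cur≤ = cur≤ ; credit = credit
                                        ; answer = inj₂ (_ , v , l , eq , Qv) }) =
        payThen (pay (pay (v , cur , B , key-≡ , Qv , cur≤ , Rep.bounded R ,
          delete (record { Rep R }) v key-≡ , ℕ.m≤n⇒m≤o+n 4 credit)))
        where
        open Rep R
        key-≡ : σ 5 (σ 4 (σ 8 0ℤ)) ≡ + toℕ v
        key-≡ =
          let _ , _ , _ , k , _ = subst (Chain (σ 5) (σ 6) nodes (σ 4 (+ cur))) eq (chains cur ℕ.≤-refl)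
          in trans (cong (λ c → σ 5 (σ 4 c)) top-≡) k

    -- The 60 credits for raising top by 1 include 30 for the added potential.
    runGrow : ∀ {cur B σ y} M x → Rep n Q cur B σ → σ 0 0ℤ ≡ y → σ 1 0ℤ ≡ + x →
              Run ⟦ grow ⟧ σ (8 + (potential B cur * 30 + ((x ∸ cur) * 60 + M))) λ j _ σ →
                Rep n Q (cur ℕ.⊔ x) B σ × σ 0 0ℤ ≡ y × σ 1 0ℤ ≡ + x ×
                potential B (cur ℕ.⊔ x) * 30 + M ≤ j
    runGrow {cur₀} {B} {y = y} M x R₀ y₀ x₀ =
      payWhile Grow step (cur₀ , R₀ , y₀ , x₀ , ℕ.≤-refl , ℕ.m≤m⊔n cur₀ x , ℕ.≤-refl)
      where
      Grow : ℕ → Store → Set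
      Grow j σ = ∃[ cur ] Rep n Q cur B σ × σ 0 0ℤ ≡ y × σ 1 0ℤ ≡ + x ×
        cur₀ ≤ cur × cur ≤ cur₀ ℕ.⊔ x ×
        8 + (potential B cur * 30 + ((x ∸ cur) * 60 + M)) ≤ j
      step : ∀ {j σ} → Grow j σ → _
      step {σ = σ} (cur , R , y= , x= , cur≥ , cur≤ , credit) = _ , credit , payCompare (top ⊕ oneE) arg₁
        (λ t<x → weaken (enough (<x t<x)) (payThen (pay (suc cur , ascend top-≡′ (record { Rep R }) , y= , x= ,
          ℕ.m≤n⇒m≤1+n cur≥ , ℕ.≤-trans (<x t<x) (ℕ.m≤n⊔m cur₀ x) , ℕ.≤-refl))))
        (λ x≤t → finish (≥x x≤t))
        where
        open Rep R
        top-≡′ : σ 8 0ℤ ℤ.+ 1ℤ ≡ + suc cur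
        top-≡′ = trans (cong (ℤ._+ 1ℤ) top-≡) (cong +_ (ℕ.+-comm cur 1))
        <x : σ 8 0ℤ ℤ.+ 1ℤ ℤ.≤ σ 1 0ℤ → cur < x
        <x t<x = ℤ.drop‿+≤+ (subst₂ ℤ._≤_ top-≡′ x= t<x)
        ≥x : σ 1 0ℤ ℤ.< σ 8 0ℤ ℤ.+ 1ℤ → x ≤ cur
        ≥x x≤t = ℕ.≤-pred (ℤ.drop‿+<+ (subst₂ ℤ._<_ x= top-≡′ x≤t))
        enough : cur < x →
          10 + (8 + (potential B (suc cur) * 30 + ((x ∸ suc cur) * 60 + M))) ≤
          potential B cur * 30 + ((x ∸ cur) * 60 + M)
        -- The new bucket is empty by `above`, so the potential grows by 1 only: 10 + 8 + 30 credits
        -- are needed, and 12 of the 60 remain.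
        enough cur<x rewrite above (suc cur) ℕ.≤-refl | ℕ.+-∸-assoc 1 cur<x =
          ℕ.≤-trans (ℕ.≤-reflexive (x∙yz≈y∙xz 48 (potential B cur * 30) _))
            (ℕ.+-monoʳ-≤ (potential B cur * 30) (ℕ.m≤n+m _ 12))
        finish : x ≤ cur → Rep n Q (cur₀ ℕ.⊔ x) B σ × σ 0 0ℤ ≡ y × σ 1 0ℤ ≡ + x ×
                 potential B (cur₀ ℕ.⊔ x) * 30 + M ≤ potential B cur * 30 + ((x ∸ cur) * 60 + M)
        finish x≤cur rewrite ℕ.≤-antisym (ℕ.⊔-lub cur≥ x≤cur) cur≤ =
          R , y= , x= , ℕ.+-monoʳ-≤ _ (ℕ.m≤n+m M _)

    runInsert : ∀ {cur B σ} M v x → Rep n Q cur B σ →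
                Run (call insert (+ toℕ v) (+ x)) σ (80 + (potential B cur * 30 + ((x ∸ cur) * 60 + M)))
                  λ j _ σ → ∃[ B′ ] Rep n (updateAt Q v (const (just x))) (cur ℕ.⊔ x) B′ σ ×
                    potential B′ (cur ℕ.⊔ x) * 30 + M ≤ j
    runInsert {cur} {B} M v x R = payThen (payThen (chain (chain
      (weaken (ℕ.m≤n+m _ 5) (mono finish (frame 65 (runGrow M x (record { Rep R }) refl refl)))))))
      where
      finish : ∀ {j σ} → ∃[ i ] j ≡ 65 + i × Rep n Q (cur ℕ.⊔ x) B σ ×
                 σ 0 0ℤ ≡ + toℕ v × σ 1 0ℤ ≡ + x × potential B (cur ℕ.⊔ x) * 30 + M ≤ i →
               Run ⟦ push ⟧ σ j λ j _ σ → Run (read (λ σ → σ 2 0ℤ)) σ j λ j z σ →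
                 ∃[ B′ ] Rep n (updateAt Q v (const (just x))) (cur ℕ.⊔ x) B′ σ ×
                   potential B′ (cur ℕ.⊔ x) * 30 + M ≤ j
      finish (i , refl , R , v= , x= , credit) =
        payThen (payThen (payThen (payThen (pay (pay
          -- Of the 65 credits kept back, 28 pay for the writes and the result, and 30 become the
          -- potential of the new node.
          (B [ x ≔ v ∷ B x ] , pushed R v x (ℕ.m≤n⊔m cur x) v= x= refl refl ,
           ℕ.≤-trans (ℕ.≤-reflexive (cong (λ z → z * 30 + M) bigger)) (ℕ.m≤n⇒m≤o+n 7 (ℕ.+-monoʳ-≤ 30 credit))))))))
        where
        c = cur ℕ.⊔ x
        bigger : potential (B [ x ≔ v ∷ B x ]) c ≡ suc (potential B c)
        bigger = trans (cong (c ℕ.+_) (ℕ.+-cancelˡ-≡ (length (B x)) _ _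
          (trans (total-≔ B c (ℕ.m≤n⊔m cur x)) (sym (ℕ.+-suc (length (B x)) _))))) (ℕ.+-suc c _)

  -- Only `prio` and the head of bucket 0 are cleared: other heads wait for `grow`, and a node is
  -- written before it is read. The 15 credits are the exact price of one round of `clear`.
  runInit : ∀ {σ} n M → Run (call init (+ n) 0ℤ) σ (30 + (n * 15 + M)) λ j z σ →
            Rep n (const nothing) 0 (const []) σ × M ≤ j
  runInit n M = payThen (payThen (chain (chain
    (mono finish (payWhile Clear step (n , refl , ℕ.≤-refl , (λ v n≤v → contradiction n≤v (ℕ.<⇒≱ (Fin.toℕ<n v))) , ℕ.m≤n+m _ 10))))))
    where
    Clear : ℕ → Store → Set
    Clear j σ = ∃[ k ] σ 0 0ℤ ≡ + k × k ≤ n × (∀ (v : Fin n) → k ≤ toℕ v → σ 3 (+ toℕ v) ≡ -1ℤ) ×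
      18 + (k * 15 + M) ≤ j
    step : ∀ {j σ} → Clear j σ → ∃[ i ] i < j × Run (compare oneE arg₀) σ i
      (Branch ⟦ set 0 zeroE (arg₀ ⊖ oneE) ⨾ set 3 arg₀ (lit -1ℤ) ⟧ Clear
        λ i _ σ → 13 + M ≤ i × (∀ (v : Fin n) → σ 3 (+ toℕ v) ≡ -1ℤ))
    step {σ = σ} (zero , k= , k≤n , cleared , credit) = _ , credit , payCompare oneE arg₀
      (λ 1≤k → contradiction (subst (1ℤ ℤ.≤_) k= 1≤k) (ℤ.<⇒≱ (+<+ (s≤s z≤n))))
      (λ _ → ℕ.≤-refl , λ v → cleared v z≤n)
    step {σ = σ} (suc k , k= , k<n , cleared , credit) = _ , credit , payCompare oneE arg₀
      (λ _ → payThen (pay (k , k=′ , ℕ.<⇒≤ k<n , cleared′ , ℕ.≤-refl)))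
      (λ k<1 → contradiction (subst (ℤ._< 1ℤ) k= k<1) (ℤ.≤⇒≯ (+≤+ (s≤s z≤n))))
      where
      k=′ : σ 0 0ℤ ℤ.- 1ℤ ≡ + k
      k=′ = cong (ℤ._- 1ℤ) k=
      cleared′ : ∀ (v : Fin n) → k ≤ toℕ v → (σ [ 3 , σ 0 0ℤ ℤ.- 1ℤ ↦ -1ℤ ]) 3 (+ toℕ v) ≡ -1ℤ
      cleared′ v k≤v with + toℕ v ℤ.≟ σ 0 0ℤ ℤ.- 1ℤ
      ... | yes _ = refl
      ... | no v≢k = cleared v (ℕ.≤∧≢⇒< k≤v λ e → v≢k (trans (cong +_ (sym e)) (sym k=′)))
    finish : ∀ {j σ} → 13 + M ≤ j × (∀ (v : Fin n) → σ 3 (+ toℕ v) ≡ -1ℤ) →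
      Run (⟦ set 8 zeroE zeroE ⨾ set 4 zeroE zeroE ⨾ set 7 zeroE oneE ⟧) σ j λ j _ σ →
      Run (read (λ σ → σ 2 0ℤ)) σ j λ j _ σ → Rep n (const nothing) 0 (const []) σ × M ≤ j
    finish (credit , cleared) = weaken credit (payThen (payThen (pay (pay (record
      { nodes = 0 ; top-≡ = refl ; free-≡ = refl ; chains = λ { zero z≤n → refl }
      ; above = λ _ _ → refl ; prio-≡ = cleared ; live = λ _ _ () } , ℕ.m≤n+m M 3)))))

  -- `Run` includes halting and the postcondition, so the cost lemmas with nothing put aside already
  -- give correctness.
  bucketQueue : PriorityQueue
  bucketQueue = record
    { init = init ; isEmpty = normalise ; insert = insert ; popMax = popMax
    ; Represents      = λ n Q σ → ∃[ cur ] ∃[ B ] Rep n Q cur B σ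
    ; init-correct    = λ n σ →
        let run h _ (R , _) = runInit {σ} n 0 in _ , _ , _ , h , 0 , _ , R
    ; isEmpty-correct = λ { (_ , _ , R) →
        let run h _ (S , z≡) = runIsEmpty 0 R
        in _ , _ , _ , h , answer⇔ S z≡ , _ , _ , Searched.rep S }
    ; insert-correct  = λ { (_ , _ , R) v x →
        let run h _ (_ , R′ , _) = runInsert 0 v x R in _ , _ , _ , h , _ , _ , R′ }
    ; popMax-correct  = λ { (_ , _ , R) some → popped (runPopMax 0 R some) }
    }
    where
    answer⇔ : ∀ {n} {Q : Content n} {cur M j σ z} → Searched {Q = Q} cur M j σ → z ≡ σ 2 0ℤ →
              z ≡ 1ℤ ⇔ (∀ v → Q v ≡ nothing)
    answer⇔ record { answer = inj₁ (flag≡1 , none) } z≡ = mk⇔ (λ _ → none) (λ _ → trans z≡ flag≡1)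
    answer⇔ record { answer = inj₂ (flag≡2 , v , _ , _ , Qv) } z≡ = mk⇔
      (λ z≡1 → contradiction (trans (sym z≡1) (trans z≡ flag≡2)) λ ())
      (λ none → contradiction (trans (sym Qv) (none v)) λ ())
    popped : ∀ {n} {Q : Content n} {σ N cur M} → Run (call popMax 0ℤ 0ℤ) σ N (Popped {Q = Q} cur M) →
             ∃[ k ] ∃[ v ] ∃[ x ] ∃[ σ′ ] call popMax 0ℤ 0ℤ σ k (+ toℕ v) σ′
               × Q v ≡ just x
               × (∀ w y → Q w ≡ just y → y ≤ x)
               × ∃[ cur ] ∃[ B ] Rep n (updateAt Q v (const nothing)) cur B σ′
    popped (run h _ (_ , _ , _ , refl , Qv , _ , max , R , _)) = _ , _ , _ , _ , h , Qv , max , _ , _ , R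

open BucketQueue

-- Sums over vertices; degree counting.

module Sums where
  open import Data.Nat.Base using (_+_; _*_)

  sum-updateAt : ∀ {n} (g : Fin n → ℕ) i f → g i + sum (updateAt g i f) ≡ f (g i) + sum g
  sum-updateAt g zero    f = x∙yz≈y∙xz (g zero) (f (g zero)) _
  sum-updateAt g (suc i) f = begin
    g (suc i) + (g zero + sum (updateAt (λ j → g (suc j)) i f))  ≡⟨ x∙yz≈y∙xz (g (suc i)) (g zero) _ ⟩
    g zero + (g (suc i) + sum (updateAt (λ j → g (suc j)) i f))  ≡⟨ cong (λ z → g zero + z) (sum-updateAt (λ j → g (suc j)) i f) ⟩
    g zero + (f (g (suc i)) + sum (λ j → g (suc j)))             ≡⟨ x∙yz≈y∙xz (g zero) (f (g (suc i))) _ ⟩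
    f (g (suc i)) + (g zero + sum (λ j → g (suc j)))             ∎
    where open ≡-Reasoning

  sum-0 : ∀ n → sum {n} (const 0) ≡ 0
  sum-0 zero = refl
  sum-0 (suc n) = sum-0 n

  sum-linear : ∀ {n} a b (g h : Fin n → ℕ) →
               sum (λ v → a + (g v * b + h v * b)) ≡ n * a + (sum g * b + sum h * b)
  sum-linear {zero}  a b g h = refl
  sum-linear {suc n} a b g h = trans
    (cong (λ z → a + (g zero * b + h zero * b) + z) (sum-linear a b (λ v → g (suc v)) (λ v → h (suc v))))
    (collect a b (g zero) (h zero) n _ _)
    where
    collect : ∀ a b x y n s t → a + (x * b + y * b) + (n * a + (s * b + t * b)) ≡
              a + n * a + ((x + s) * b + (y + t) * b)
    collect = solve-∀

  -- Double counting: a new element `e` enlarges the fibre over `f e` and no other. For `src` and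
  -- `tgt` this is the degree sum formula.
  sum-fibres : ∀ {n} {A : Set} (f : A → Fin n) (es : List A) →
               sum (λ v → length (filter (λ e → f e Fin.≟ v) es)) ≡ length es
  sum-fibres {n} f []       = sum-0 n
  sum-fibres {n} f (e ∷ es) = begin
    sum (fibre (e ∷ es))                 ≡⟨ sum-cong-≗ step ⟩
    sum (updateAt (fibre es) (f e) suc)  ≡⟨ ℕ.+-cancelˡ-≡ (fibre es (f e)) _ _
                                              (trans (sum-updateAt (fibre es) (f e) suc) (sym (ℕ.+-suc _ _))) ⟩
    suc (sum (fibre es))                 ≡⟨ cong suc (sum-fibres f es) ⟩
    suc (length es)                      ∎
    where
    open ≡-Reasoning
    fibre : List _ → Fin n → ℕ
    fibre es v = length (filter (λ e → f e Fin.≟ v) es)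
    step : ∀ v → fibre (e ∷ es) v ≡ updateAt (fibre es) (f e) suc v
    step v with f e Fin.≟ v
    ... | yes refl = sym (updateAt-updates (f e) (fibre es))
    ... | no  fe≢v = sym (updateAt-minimal v (f e) (fibre es) (λ eq → fe≢v (sym eq)))

  length-allFin : ∀ k → length (allFin k) ≡ k
  length-allFin k = length-tabulate {n = k} id

  sum-allFin : ∀ {m n} (f : Fin m → Fin n) →
               sum (λ v → length (filter (λ e → f e Fin.≟ v) (allFin m))) ≡ m
  sum-allFin {m} f = trans (sum-fibres f (allFin m)) (length-allFin m)

open Sums

-- The run of Relief: ranks, slacks and offers.

module Analysis where
  open import Data.Nat.Base using (_+_; _*_; _∸_; _≤_; _<_)
  open import Data.List.Membership.Propositional using (_∈_)

  positivePart : ∀ {x} → 0ℤ ℤ.< x ℤ.⊔ 0ℤ → ∃[ k ] x ≡ + k × 0 < k × x ℤ.⊔ 0ℤ ≡ + k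
  positivePart {+ suc k}  _ = suc k , refl , s≤s z≤n , refl
  positivePart {+ zero}   (+<+ ())
  positivePart { -[1+ _ ]} (+<+ ())

  ⌊⌋-true : ∀ {A : Set} (d : Dec A) → ⌊ d ⌋ ≡ true → A
  ⌊⌋-true (yes a) _ = a

  runWhen : ∀ {S : Set} {σ : S} {c N P} b → (b ≡ true → Run c σ N P) →
            Run skip σ N P → Run (when b c) σ N P
  runWhen true  f g = f refl
  runWhen false f g = g

  nonNegative : ∀ {i b} → 0ℤ ℤ.≤ i → i ℤ.≤ + b → ∃[ x ] i ≡ + x × x ≤ b
  nonNegative (+≤+ _) (+≤+ x≤b) = _ , refl , x≤b

  -- A forward edge stays forward when its head has been raised at least as much as its tail; `a`
  -- and `c` are the old ranks of tail and head.
  popped-ahead : ∀ {a c b τ} → a ℤ.< c → b ℤ.≤ τ → ¬ (c ℤ.+ τ ℤ.≤ a ℤ.+ b)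
  popped-ahead a<c b≤τ = ℤ.<⇒≱ (ℤ.+-mono-<-≤ a<c b≤τ)

  out-offer : ∀ {a c b} → a ℤ.< c → c ℤ.≤ a ℤ.+ + b →
              ∃[ x ] a ℤ.+ + b ℤ.+ 1ℤ ℤ.- c ≡ + x × x ≤ b
  out-offer {a} {c} {b} a<c c≤ = nonNegative
    (subst (0ℤ ℤ.≤_) (above c (a ℤ.+ + b)) (ℤ.+-mono-≤ (ℤ.i≤j⇒0≤j-i c≤) (+≤+ (z≤n {1}))))
    (subst₂ ℤ._≤_ (below a (+ b) c) (ℤ.+-identityʳ (+ b))
      (ℤ.+-monoʳ-≤ (+ b) (ℤ.i≤j⇒i-j≤0 (ℤ.i<j⇒suc[i]≤j a<c))))
    where
    above : ∀ c d → d ℤ.- c ℤ.+ 1ℤ ≡ d ℤ.+ 1ℤ ℤ.- c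
    above = ℤSolver.solve-∀
    below : ∀ a b c → b ℤ.+ (1ℤ ℤ.+ a ℤ.- c) ≡ a ℤ.+ b ℤ.+ 1ℤ ℤ.- c
    below = ℤSolver.solve-∀

  -- Now `a` is the old rank of the head and `c` that of the tail. The tail rose at least as much as
  -- the head, so the difference did not grow, and truncation at 0 is monotone.
  popped-slack : ∀ a c {b τ} → b ℤ.≤ τ →
    (a ℤ.+ b ℤ.- (c ℤ.+ τ) ℤ.- 1ℤ) ℤ.⊔ 0ℤ ℤ.≤ (a ℤ.- c ℤ.- 1ℤ) ℤ.⊔ 0ℤ
  popped-slack a c {b} {τ} b≤τ = ℤ.⊔-monoˡ-≤ 0ℤ (subst₂ ℤ._≤_ (left a c b τ) (ℤ.+-identityʳ _)
    (ℤ.+-monoʳ-≤ (a ℤ.- c ℤ.- 1ℤ) (ℤ.i≤j⇒i-j≤0 b≤τ)))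
    where
    left : ∀ a c b τ → a ℤ.- c ℤ.- 1ℤ ℤ.+ (b ℤ.- τ) ≡ a ℤ.+ b ℤ.- (c ℤ.+ τ) ℤ.- 1ℤ
    left = ℤSolver.solve-∀

  -- Truncation at 0 is 1-Lipschitz, so raising the head by `b` adds at most `b` to the slack.
  in-offer : ∀ a c b → let slack = (a ℤ.- c ℤ.- 1ℤ) ℤ.⊔ 0ℤ
                           slack′ = (a ℤ.+ + b ℤ.- c ℤ.- 1ℤ) ℤ.⊔ 0ℤ in
             slack ℤ.< slack′ → ∃[ x ] slack′ ℤ.- slack ≡ + x × x ≤ b
  in-offer a c b s<s′ = nonNegative (ℤ.i≤j⇒0≤j-i (ℤ.<⇒≤ s<s′))
    (subst (slack′ ℤ.- slack ℤ.≤_) (cancel slack (+ b)) (ℤ.+-monoˡ-≤ (ℤ.- slack) (ℤ.⊔-lub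
      (subst (ℤ._≤ slack ℤ.+ + b) (shift a c (+ b)) (ℤ.+-monoˡ-≤ (+ b) (ℤ.i≤i⊔j (a ℤ.- c ℤ.- 1ℤ) 0ℤ)))
      (ℤ.+-mono-≤ (ℤ.i≤j⊔i (a ℤ.- c ℤ.- 1ℤ) 0ℤ) (+≤+ (z≤n {b}))))))
    where
    slack′ = (a ℤ.+ + b ℤ.- c ℤ.- 1ℤ) ℤ.⊔ 0ℤ
    slack = (a ℤ.- c ℤ.- 1ℤ) ℤ.⊔ 0ℤ
    shift : ∀ a c b → a ℤ.- c ℤ.- 1ℤ ℤ.+ b ≡ a ℤ.+ b ℤ.- c ℤ.- 1ℤ
    shift = ℤSolver.solve-∀
    cancel : ∀ s b → s ℤ.+ b ℤ.- s ≡ b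
    cancel = ℤSolver.solve-∀

  module _ (G : Graph) (L : AdjacencyLists G) (H : Graph.Subgraph G) (r : Graph.Rank G)
           (pₛ : Graph.Edge G) where
    open Graph G
    open AdjacencyLists L
    open State using (F; r′; t; parent; queue)

    private
      St : Set
      St = State bucketQueue G L

      p s : Vertex
      p = src pₛ
      s = tgt pₛ

    runOnQueue : ∀ {A : Set} {c : Com Store A} {σ : St} {N P} →
                 Run c (queue σ) N (λ j a q → P j a (record σ { queue = q })) →
                 Run (OnQueue bucketQueue G L c) σ N P
    runOnQueue (run h l p) = run (onQueue h) l p

    -- The invariant and the scanning of edges.

    -- A scan costs 87, and 1 more for the list traversal. The 165 cover the rest of the visit and
    -- restore the 160 credits that `Loop` holds for the next test and removal.
    scanCost weight : Vertex → ℕ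
    scanCost v = length (out v) * 88 + length (inn v) * 88
    weight v = 165 + scanCost v

    -- ord v is the position of v in the order of removal from the queue.
    Order : Set
    Order = Vertex → Maybe ℕ

    -- What the removals still to come may cost.
    pending : Order → ℕ
    pending ord = sum λ v → maybe (const 0) (weight v) (ord v)

    totalWeight : ℕ
    totalWeight = sum weight

    -- b is the priority removed last, and d the number of removals so far;
    -- the other indices are r′ v, t v, parent v, ord v and the priority of v.
    data Status (ord : Order) (b d : ℕ) (v : Vertex) (ρ τ : ℤ) (π : Vertex) :
                Maybe ℕ → Maybe ℕ → Set where
      popped : ∀ {i} → ρ ≡ r v ℤ.+ τ → + b ℤ.≤ τ → i < d →
               v ≡ p ⊎ (∃[ j ] ord π ≡ just j × j < i) →
               Status ord b d v ρ τ π (just i) nothing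
      queued : ∀ {x} → ρ ≡ r v → τ ≡ + x → x ≤ b →
               v ≡ p ⊎ (∃[ j ] ord π ≡ just j) →
               Status ord b d v ρ τ π nothing (just x)
      idle   : ρ ≡ r v → τ ≡ 0ℤ → Status ord b d v ρ τ π nothing nothing

    -- The dichotomy behind both scans: the first case contradicts the guard of the scan, the second
    -- computes the offer from the old rank.
    removedOrFresh : ∀ {ord b d v ρ τ π o q} → Status ord b d v ρ τ π o q →
               (ρ ≡ r v ℤ.+ τ × + b ℤ.≤ τ) ⊎ (ρ ≡ r v × o ≡ nothing)
    removedOrFresh (popped ρ≡ b≤τ _ _) = inj₁ (ρ≡ , b≤τ)
    removedOrFresh (queued ρ≡ _ _ _)   = inj₂ (ρ≡ , refl)
    removedOrFresh (idle ρ≡ _)         = inj₂ (ρ≡ , refl)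

    untouched : ∀ {ord b d v ρ τ π o q} → Status ord b d v ρ τ π o q → o ≡ nothing → ρ ≡ r v
    untouched (queued ρ≡ _ _ _) _ = ρ≡
    untouched (idle ρ≡ _)       _ = ρ≡

    record Invariant (T : ℕ) (ord : Order) (b d : ℕ) (Q : Content n) (σ : St) : Set where
      field
        F-≡    : ∀ e → lookup (F σ) e ≡ lookup H e
        t-p    : t σ p ≡ + T
        b≤T    : b ≤ T
        -- A removal adds 1 to `d` and takes a positive weight from `pending`. This bounds `d`, and
        -- with it the path of the augmentation.
        count  : d + pending ord ≤ totalWeight
        status : ∀ v → Status ord b d v (r′ σ v) (t σ v) (parent σ v) (ord v) (Q v)

    -- The state in which the edges at u, the vertex removed last, are scanned.
    record Scan (T : ℕ) (ord : Order) (b d : ℕ) (u : Vertex) (M j : ℕ) (σ : St) : Set where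
      field
        {Q}    : Content n
        {B}    : Buckets n
        inv    : Invariant T ord b d Q σ
        rep    : Rep n Q b B (queue σ)
        isLast : ∃[ i ] ord u ≡ just i
        t-u    : t σ u ≡ + b
        credit : potential B b * 30 + M ≤ j

      open Invariant inv public

      r′-u : r′ σ u ≡ r u ℤ.+ + b
      r′-u with removedOrFresh (status u)
      ... | inj₁ (ρ≡ , _)    = trans ρ≡ (cong (λ τ → r u ℤ.+ τ) t-u)
      ... | inj₂ (_ , fresh) with () ← trans (sym fresh) (proj₂ isLast)

    enrich : ∀ {T ord b d u M j j′ σ} → j ≤ j′ → Scan T ord b d u M j σ → Scan T ord b d u M j′ σ
    enrich j≤j′ S = record { Scan S ; credit = ℕ.≤-trans (Scan.credit S) j≤j′ }

    -- `top` stands at `b`, so an offer of at most `b` never makes it climb, and a constant number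
    -- of credits suffices.
    runOffer : ∀ {T ord b d u M N σ} v e {x τ} → τ ≡ + x → x ≤ b → ord v ≡ nothing →
               Scan T ord b d u M N σ →
               Run (offer bucketQueue G L u v e τ) σ (85 + N) λ j _ σ → Scan T ord b d u M j σ
    runOffer {T} {ord} {b} {d} {u} {M} {N} {σ} v e {x} refl x≤b fresh S =
      payThen (runWhen ⌊ t σ v ℤ.<? + x ⌋
        (λ larger → payThen (chain (chain (runOnQueue (weaken enough (mono
          (λ { (i , refl , B′ , R , credit) →
               pay (payThen (pay (added (⌊⌋-true (t σ v ℤ.<? + x) larger) R credit))) })
          (frame 3 (runInsert M v x (record { Rep rep })))))))))
        (pay (enrich (ℕ.m≤n+m N 83) S)))
      where
      open Scan S
      enough : 3 + (80 + (potential B b * 30 + ((x ∸ b) * 60 + M))) ≤ 83 + N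
      enough rewrite ℕ.m≤n⇒m∸n≡0 x≤b = ℕ.+-monoʳ-≤ 83 credit

      added : ∀ {j q B′ via′} → t σ v ℤ.< + x →
              Rep n (updateAt Q v (const (just x))) (b ℕ.⊔ x) B′ q →
              potential B′ (b ℕ.⊔ x) * 30 + M ≤ j →
              Scan T ord b d u M j record σ
                { t = updateAt (t σ) v (const (+ x)) ; queue = q
                ; parent = updateAt (parent σ) v (const u) ; via = via′ }
      added larger R credit rewrite ℕ.m≥n⇒m⊔n≡m x≤b = record
        { inv = record
          { F-≡ = F-≡ ; b≤T = b≤T ; count = count
          ; t-p = trans (updateAt-minimal p v (t σ) p≢v) t-p
          ; status = status′ }
        ; rep = R ; isLast = isLast
        ; t-u = trans (updateAt-minimal u v (t σ) u≢v) t-u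
        ; credit = credit }
        where
        -- `t p` is `T`, which no offer exceeds; hence `p` never acquires a parent.
        p≢v : p ≢ v
        p≢v refl = ℤ.<⇒≱ (subst (ℤ._< + x) t-p larger) (+≤+ (ℕ.≤-trans x≤b b≤T))
        u≢v : u ≢ v
        u≢v refl with () ← trans (sym fresh) (proj₂ isLast)
        status′ : ∀ w → Status ord b d w (r′ σ w) (updateAt (t σ) v (const (+ x)) w)
                    (updateAt (parent σ) v (const u) w) (ord w) (updateAt Q v (const (just x)) w)
        status′ w with w Fin.≟ v
        ... | no w≢v rewrite updateAt-minimal w v {const (+ x)} (t σ) w≢v
                           | updateAt-minimal w v {const u} (parent σ) w≢v
                           | updateAt-minimal w v {const (just x)} Q w≢v = status w
        ... | yes refl rewrite updateAt-updates v {const (+ x)} (t σ)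
                             | updateAt-updates v {const u} (parent σ)
                             | updateAt-updates v {const (just x)} Q =
          subst (λ o → Status ord b d v (r′ σ v) (+ x) u o (just x)) (sym fresh)
            (queued (untouched (status v) fresh) refl x≤b (inj₂ isLast))

    runScanOut : Conforms r H → ∀ {T ord b d u M N σ} e → src e ≡ u → Scan T ord b d u M N σ →
                 Run (scanOut bucketQueue G L u e) σ (87 + N) λ j _ σ → Scan T ord b d u M j σ
    runScanOut conforms {T} {ord} {b} {d} {u} {M} {N} {σ} e refl S = payThen (runWhen _
      (λ tight → payThen (go
        (forward (not-injective (∧-conicalˡ _ _ tight)))
        (subst (r′ σ v ℤ.≤_) r′-u
          (⌊⌋-true (r′ σ v ℤ.≤? r′ σ u) (∧-conicalʳ (not (lookup (F σ) e)) _ tight)))))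
      (pay (enrich (ℕ.m≤n+m N 85) S)))
      where
      open Scan S
      v = tgt e
      forward : lookup (F σ) e ≡ false → r u ℤ.< r v
      forward e∉F = ℤ.≰⇒> λ back →
        contradiction (trans (sym ([]=⇒lookup (conforms e back))) (trans (sym (F-≡ e)) e∉F)) λ ()
      go : r u ℤ.< r v → r′ σ v ℤ.≤ r u ℤ.+ + b →
           Run (offer bucketQueue G L u v e (r′ σ u ℤ.+ 1ℤ ℤ.- r′ σ v)) σ (85 + N)
             λ j _ σ → Scan T ord b d u M j σ
      go fwd r′≤ with removedOrFresh (status v)
      ... | inj₁ (ρ≡ , b≤τ) =
        contradiction (subst (ℤ._≤ r u ℤ.+ + b) ρ≡ r′≤) (popped-ahead fwd b≤τ)
      ... | inj₂ (ρ≡ , fresh) =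
        let x , τ≡ , x≤b = out-offer fwd (subst (ℤ._≤ r u ℤ.+ + b) ρ≡ r′≤)
        in runOffer v e (trans (cong₂ (λ ρ ρ′ → ρ ℤ.+ 1ℤ ℤ.- ρ′) r′-u ρ≡) τ≡) x≤b fresh S

    runScanIn : ∀ {T ord b d u M N σ} e → tgt e ≡ u → Scan T ord b d u M N σ →
                Run (scanIn bucketQueue G L r u e) σ (87 + N) λ j _ σ → Scan T ord b d u M j σ
    runScanIn {T} {ord} {b} {d} {u} {M} {N} {σ} e refl S = payThen (runWhen _
      (λ tight → payThen (go
        (⌊⌋-true (slack e r ℤ.<? slack e (r′ σ)) (∧-conicalʳ (lookup (F σ) e) _ tight))))
      (pay (enrich (ℕ.m≤n+m N 85) S)))
      where
      open Scan S
      v = src e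
      go : slack e r ℤ.< slack e (r′ σ) →
           Run (offer bucketQueue G L u v e (slack e (r′ σ) ℤ.- slack e r)) σ (85 + N)
             λ j _ σ → Scan T ord b d u M j σ
      go grows with removedOrFresh (status v)
      ... | inj₁ (ρ≡ , b≤τ) = contradiction
        (subst₂ (λ ρ ρ′ → slack e r ℤ.< (ρ ℤ.- ρ′ ℤ.- 1ℤ) ℤ.⊔ 0ℤ) r′-u ρ≡ grows)
        (ℤ.≤⇒≯ (popped-slack (r u) (r v) b≤τ))
      ... | inj₂ (ρ≡ , fresh) =
        let x , τ≡ , x≤b = in-offer (r u) (r v) b
              (subst₂ (λ ρ ρ′ → slack e r ℤ.< (ρ ℤ.- ρ′ ℤ.- 1ℤ) ℤ.⊔ 0ℤ) r′-u ρ≡ grows)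
        in runOffer v e (trans (cong₂ (λ ρ ρ′ → (ρ ℤ.- ρ′ ℤ.- 1ℤ) ℤ.⊔ 0ℤ ℤ.- slack e r) r′-u ρ≡) τ≡)
             x≤b fresh S

    -- Inversion of `queued`, with the last index generalised because `Q v` does not unify with a
    -- constructor.
    awaiting : ∀ {ord b d v ρ τ π o q x} → Status ord b d v ρ τ π o q → q ≡ just x →
               o ≡ nothing × ρ ≡ r v × τ ≡ + x × (v ≡ p ⊎ (∃[ j ] ord π ≡ just j))
    awaiting (queued ρ≡ τ≡ _ par) refl = refl , ρ≡ , τ≡ , par

    position<d : ∀ {ord b d v ρ τ π o q i} → Status ord b d v ρ τ π o q → o ≡ just i → i < d
    position<d (popped _ _ i<d _) refl = i<d

    pending-updateAt : ∀ ord u d → ord u ≡ nothing →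
                       weight u + pending (updateAt ord u (const (just d))) ≡ pending ord
    pending-updateAt ord u d fresh = begin
      weight u + pending ord′             ≡⟨ cong₂ _+_ (cong (maybe (const 0) (weight u)) (sym fresh)) (sum-cong-≗ step) ⟩
      g u + sum (updateAt g u (const 0))  ≡⟨ sum-updateAt g u (const 0) ⟩
      pending ord                         ∎
      where
      open ≡-Reasoning
      ord′ = updateAt ord u (const (just d))
      g : Vertex → ℕ
      g v = maybe (const 0) (weight v) (ord v)
      step : ∀ v → maybe (const 0) (weight v) (ord′ v) ≡ updateAt g u (const 0) v
      step v with v Fin.≟ u
      ... | yes refl = trans (cong (maybe (const 0) (weight v)) (updateAt-updates v ord))
                         (sym (updateAt-updates v g))
      ... | no v≢u = trans (cong (maybe (const 0) (weight v)) (updateAt-minimal v u ord v≢u))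
                       (sym (updateAt-minimal v u g v≢u))

    -- Lowering `b` to `b′` is safe on both sides: it weakens the lower bound for removed vertices,
    -- and maximality gives the upper bound for waiting ones. The new position `d` exceeds all
    -- earlier ones, in particular that of the parent of `u`.
    remove : ∀ {T ord b d Q σ} u {b′ B q M j} → Invariant T ord b d Q σ →
             Q u ≡ just b′ → b′ ≤ b → (∀ w y → Q w ≡ just y → y ≤ b′) →
             Rep n (updateAt Q u (const nothing)) b′ B q → potential B b′ * 30 + M ≤ j →
             ord u ≡ nothing ×
             Scan T (updateAt ord u (const (just d))) b′ (suc d) u M j
               record σ { queue = q ; r′ = updateAt (r′ σ) u (ℤ._+ t σ u) }
    remove {T} {ord} {b} {d} {Q} {σ} u {b′} I Qu b′≤b max R credit = fresh , record
      { inv = record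
        { F-≡ = F-≡ ; t-p = t-p ; b≤T = ℕ.≤-trans b′≤b b≤T
        ; count = ℕ.≤-trans (ℕ.≤-reflexive (sym (ℕ.+-suc d (pending ord′))))
                    (ℕ.≤-trans (ℕ.+-monoʳ-≤ d fewer) count)
        ; status = status′ }
      ; rep = R ; isLast = d , updateAt-updates u ord ; t-u = t-u ; credit = credit }
      where
      open Invariant I
      ord′ = updateAt ord u (const (just d))
      fresh = proj₁ (awaiting (status u) Qu)
      t-u = proj₁ (proj₂ (proj₂ (awaiting (status u) Qu)))
      fewer : suc (pending ord′) ≤ pending ord
      fewer = subst (λ k → suc (pending ord′) ≤ k) (pending-updateAt ord u d fresh)
        (s≤s (ℕ.m≤n+m (pending ord′) (164 + scanCost u)))
      older : ∀ {v j} → ord v ≡ just j → ord′ v ≡ just j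
      older {v} eq = trans (updateAt-minimal v u ord v≢u) eq
        where
        v≢u : v ≢ u
        v≢u refl with () ← trans (sym fresh) eq
      keep : ∀ {w ρ τ π o q} → q ≡ Q w → Status ord b d w ρ τ π o q → Status ord′ b′ (suc d) w ρ τ π o q
      keep _ (popped ρ≡ b≤τ i<d par) = popped ρ≡ (ℤ.≤-trans (+≤+ b′≤b) b≤τ) (ℕ.m≤n⇒m≤1+n i<d)
        (map₂ (λ { (j , eq , j<i) → j , older eq , j<i }) par)
      keep {w} eq (queued ρ≡ τ≡ _ par) = queued ρ≡ τ≡ (max w _ (sym eq))
        (map₂ (λ { (j , eq) → j , older eq }) par)
      keep _ (idle ρ≡ τ≡) = idle ρ≡ τ≡
      status′ : ∀ w → Status ord′ b′ (suc d) w (updateAt (r′ σ) u (ℤ._+ t σ u) w) (t σ w)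
                  (parent σ w) (ord′ w) (updateAt Q u (const nothing) w)
      status′ w with w Fin.≟ u
      ... | no w≢u rewrite updateAt-minimal w u {ℤ._+ t σ u} (r′ σ) w≢u
                         | updateAt-minimal w u {const (just d)} ord w≢u
                         | updateAt-minimal w u {const nothing} Q w≢u = keep refl (status w)
      ... | yes refl rewrite updateAt-updates u {ℤ._+ t σ u} (r′ σ)
                           | updateAt-updates u {const (just d)} ord
                           | updateAt-updates u {const nothing} Q
                           with awaiting (status u) Qu
      ...   | _ , ρ≡ , τ≡ , par = popped (cong (ℤ._+ t σ u) ρ≡)
        (ℤ.≤-reflexive (sym τ≡)) ℕ.≤-refl
        (map₂ (λ { (j , eq) → j , older eq , position<d (status (parent σ u)) eq }) par)

    -- The main loop.

    record Loop (T M j : ℕ) (σ : St) : Set where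
      field
        {ord}  : Order
        {b d}  : ℕ
        {Q}    : Content n
        {B}    : Buckets n
        inv    : Invariant T ord b d Q σ
        rep    : Rep n Q b B (queue σ)
        credit : potential B b * 30 + (160 + (pending ord + M)) ≤ j

    record Drained (T M j : ℕ) (σ : St) : Set where
      field
        {ord}  : Order
        {b d}  : ℕ
        {Q}    : Content n
        inv    : Invariant T ord b d Q σ
        empty  : ∀ v → Q v ≡ nothing
        credit : M ≤ j

    runScans : Conforms r H → ∀ {T ord b d u M N σ} →
               Scan T ord b d u (suc (length (inn u) * 88) + M) N σ →
               Run (forEach (out u) (scanOut bucketQueue G L u) >> forEach (inn u) (scanIn bucketQueue G L r u))
                 σ (suc (length (out u) * 88) + N) λ j _ σ → Scan T ord b d u M j σ
    runScans conforms {T} {ord} {b} {d} {u} {M} S = chain (payForEach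
      (λ es j σ → All (λ e → src e ≡ u) es × Scan T ord b d u (suc (length (inn u) * 88) + M) j σ) 87
      (λ { {e} (eq ∷ eqs , S) → mono (λ S → eqs , S) (runScanOut conforms e eq S) })
      -- The price of the second traversal was part of the credits put aside during the first; it is
      -- released here.
      (λ (_ , S) → weaken
        (ℕ.≤-trans (ℕ.≤-reflexive (x∙yz≈y∙xz (suc (length (inn u) * 88)) (potential (Scan.B S) b * 30) M))
          (Scan.credit S))
        (payForEach
          (λ es j σ → All (λ e → tgt e ≡ u) es × Scan T ord b d u M j σ) 87
          (λ { {e} (eq ∷ eqs , S) → mono (λ S → eqs , S) (runScanIn e eq S) })
          proj₂ (inn u)
          (All-resp-↭ (↭-sym (inn-↭ u)) (all-filter (λ e → tgt e Fin.≟ u) (allFin m)) ,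
           record { Scan S ; credit = ℕ.≤-refl })))
      (out u) (All-resp-↭ (↭-sym (out-↭ u)) (all-filter (λ e → src e Fin.≟ u) (allFin m)) , S))

    -- The loop body after `pop`, repeated here so that the postcondition of `pop` can speak of it.
    visit : Vertex → Com St ⊤
    visit u = do
      modify λ σ → record σ { r′ = updateAt (r′ σ) u (ℤ._+ t σ u) }
      forEach (out u) (scanOut bucketQueue G L u)
      forEach (inn u) (scanIn bucketQueue G L r u)

    runMainLoop : Conforms r H → ∀ {T M N σ} → Loop T M N σ →
                  Run (mainLoop bucketQueue G L r) σ N λ j _ σ → Drained T M j σ
    runMainLoop conforms {T} {M} ℓ = payWhile (Loop T M) step ℓ
      where
      step : ∀ {j σ} → Loop T M j σ → ∃[ i ] i < j ×
             Run (nonEmpty bucketQueue G L) σ i (Branch _ (Loop T M) λ j _ σ → Drained T M j σ)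
      -- 160 = 1 + 63 + 96: the credit lost in every round, the emptiness test, and a reserve of 1
      -- for reading the answer, 80 for the removal and 15 for the visit.
      step {σ = σ} ℓ = _ , ℕ.≤-trans (ℕ.≤-reflexive enough) credit ,
        chain (runOnQueue (mono emptied (frame 96 (runIsEmpty {cur = b} {B} (pending ord + M) rep))))
        where
        open Loop ℓ
        enough : suc (96 + (63 + (potential B b * 30 + (pending ord + M)))) ≡
                 potential B b * 30 + (160 + (pending ord + M))
        enough = x∙yz≈y∙xz 160 (potential B b * 30) (pending ord + M)
        affordable : ∀ u {pot i} → ord u ≡ nothing → pot + (pending ord + M) ≤ i →
          1 + (suc (length (out u) * 88) + (pot + (suc (length (inn u) * 88) +
            (160 + (pending (updateAt ord u (const (just d))) + M))))) ≤ 15 + i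
        affordable u {pot} {i} fresh credit = begin
          rest
            ≤⟨ ℕ.m≤n+m rest 17 ⟩
          17 + rest
            ≡⟨ regroup outs pot inns (pending ord′) M ⟩
          15 + (pot + (weight u + pending ord′ + M))
            ≡⟨ cong (λ z → 15 + (pot + (z + M))) {weight u + pending ord′} (pending-updateAt ord u d fresh) ⟩
          15 + (pot + (pending ord + M))
            ≤⟨ ℕ.+-monoʳ-≤ 15 credit ⟩
          15 + i
            ∎
          where
          open ℕ.≤-Reasoning
          ord′ = updateAt ord u (const (just d))
          outs = length (out u) * 88
          inns = length (inn u) * 88
          rest = 1 + (suc outs + (pot + (suc inns + (160 + (pending ord′ + M)))))
          regroup : ∀ x y z w M → 17 + (1 + (suc x + (y + (suc z + (160 + (w + M)))))) ≡
                    15 + (y + ((165 + (x + z)) + w + M))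
          regroup = solve-∀
        emptied : ∀ {j z q} →
          ∃[ i ] j ≡ 96 + i × Searched {Q = Q} b (pending ord + M) i q × z ≡ q 2 0ℤ →
          Run (read λ _ → not ⌊ z ℤ.≟ 1ℤ ⌋) (record σ { queue = q }) j
            (Branch _ (Loop T M) λ j _ σ → Drained T M j σ)
        -- Once `z` is a numeral, the test in `nonEmpty` computes.
        emptied (i , refl , record { cur = cur ; B = B ; credit = credit ; answer = inj₁ (flag≡1 , none) } , z≡)
          with refl ← trans z≡ flag≡1 =
          pay record { inv = record { Invariant inv } ; empty = none
                     ; credit = ℕ.m≤n⇒m≤o+n 95
                         (ℕ.m+n≤o⇒n≤o (pending ord) (ℕ.m+n≤o⇒n≤o (potential B cur * 30) credit)) }
        emptied {q = q} (i , refl , record { cur = cur ; B = B ; rep = R ; cur≤ = cur≤ ; credit = credit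
                                          ; answer = inj₂ (flag≡2 , v , _ , _ , Qv) } , z≡)
          with refl ← trans z≡ flag≡2 =
          pay (weaken (ℕ.+-monoʳ-≤ 95 credit) (chain (chain (runOnQueue
            (mono afterPop (frame 15 (runPopMax {cur = cur} {B} (pending ord + M) R
              (λ none → contradiction (trans (sym Qv) (none v)) λ ()))))))))
          where
          afterPop : ∀ {j z q} → ∃[ i ] j ≡ 15 + i × Popped {Q = Q} cur (pending ord + M) i z q →
            Run (AsVertex bucketQueue G L z) (record σ { queue = q }) j λ j u σ →
              Run (visit u) σ j λ j _ σ → Loop T M j σ
          afterPop (i , refl , u , b′ , B′ , refl , Qu , b′≤cur , max , R , credit) =
            let fresh , S = remove u inv Qu (ℕ.≤-trans b′≤cur cur≤) max R ℕ.≤-refl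
            in run asVertex ℕ.≤-refl (weaken (affordable u fresh credit) (payThen
                 (mono (λ S → record { inv = Scan.inv S ; rep = Scan.rep S ; credit = Scan.credit S })
                   (runScans conforms S))))

    -- The augmentation.

    -- All that the walk needs of the invariant. It depends on the state through `parent` alone, so
    -- changes of `O` and `x` preserve it definitionally.
    Descending : Order → St → Set
    Descending ord σ = ∀ v i → ord v ≡ just i → v ≡ p ⊎ (∃[ j ] ord (parent σ v) ≡ just j × j < i)

    descending : ∀ {T ord b d Q σ} → Invariant T ord b d Q σ → Descending ord σ
    descending {ord = ord} {b} {d} {σ = σ} I v i = go (Invariant.status I v)
      where
      go : ∀ {ρ τ o q} → Status ord b d v ρ τ (parent σ v) o q → o ≡ just i →
           v ≡ p ⊎ (∃[ j ] ord (parent σ v) ≡ just j × j < i)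
      go (popped _ _ _ par) refl = par

    -- The path reaches p since positions decrease along it.
    runWalk : ∀ {ord σ M} i → ord (State.x σ) ≡ just i → Descending ord σ →
      Run (While (read λ σ → not ⌊ State.x σ Fin.≟ p ⌋) (do
            modify λ σ → record σ { O = State.O σ [ State.via σ (State.x σ) ]≔ true }
            modify λ σ → record σ { x = parent σ (State.x σ) }))
        σ (2 + (i * 4 + M)) λ j _ _ → M ≤ j
    runWalk {ord} {M = M} i at desc = payWhile Walk step (i , at , desc , ℕ.≤-refl)
      where
      Walk : ℕ → St → Set
      Walk j σ = ∃[ i ] ord (State.x σ) ≡ just i × Descending ord σ × 2 + (i * 4 + M) ≤ j
      step : ∀ {j σ} → Walk j σ → ∃[ i ] i < j ×
             Run (read λ σ → not ⌊ State.x σ Fin.≟ p ⌋) σ i (Branch _ Walk λ j _ _ → M ≤ j)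
      step {σ = σ} (i , at , desc , credit) = _ , credit , pay go
        where
        go : Branch _ Walk (λ j _ _ → M ≤ j) (i * 4 + M) (not ⌊ State.x σ Fin.≟ p ⌋) σ
        go with State.x σ Fin.≟ p | desc _ i at
        ... | yes _ | _ = ℕ.m≤n+m M (i * 4)
        ... | no x≢p | inj₁ x≡p = contradiction x≡p x≢p
        ... | no _ | inj₂ (j , at′ , j<i) =
          weaken (ℕ.+-monoˡ-≤ M (ℕ.*-monoˡ-≤ 4 j<i))
            (payThen (pay (j , at′ , desc , ℕ.≤-refl)))

    augmentCost : ℕ → ℕ
    augmentCost N = suc (length (allFin m) * 2) +
      (1 + (2 + (totalWeight * 4 + (suc (length (allFin m) * 2) + (1 + N)))))

    runAugment : ∀ {T ord b d Q σ N i} → Invariant T ord b d Q σ → ord s ≡ just i →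
                 Run (augment bucketQueue G L pₛ) σ (augmentCost N) λ _ _ _ → ⊤
    runAugment {ord = ord} {d = d} {N = N} {i} I at = chain (payForEach
      (λ _ j σ → Descending ord σ × rest ≤ j) 1
      (λ { (desc , credit) → pay (desc , credit) })
      (λ { (desc , credit) → weaken credit (payThen (chain (weaken i≤totalWeight (mono
        (λ credit → weaken credit (chain (payForEach (λ _ j _ → 1 + N ≤ j) 1 pay
          (λ credit → weaken credit (pay tt)) (allFin m) ℕ.≤-refl)))
        (runWalk i at desc))))) })
      (allFin m) (descending I , ℕ.≤-refl))
      where
      open Invariant I
      flipping = suc (length (allFin m) * 2) + (1 + N)
      rest = 1 + (2 + (totalWeight * 4 + flipping))
      -- Coarser than a bound by `n`, but immediate from `count` and still linear in `n + m`.
      i≤totalWeight : 2 + (i * 4 + flipping) ≤ 2 + (totalWeight * 4 + flipping)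
      i≤totalWeight = ℕ.+-monoʳ-≤ 2 (ℕ.+-monoˡ-≤ flipping (ℕ.*-monoˡ-≤ 4
        (ℕ.≤-trans (ℕ.<⇒≤ (position<d (status s) at)) (ℕ.≤-trans (ℕ.m≤m+n d _) count))))

    -- Initialization.

    Initialized : ℕ → St → Set
    Initialized T σ = (∀ e → lookup (F σ) e ≡ lookup H e) × (∀ v → r′ σ v ≡ r v) ×
      (∀ v → t σ v ≡ updateAt (const 0ℤ) p (const (+ T)) v)

    -- Before any removal, `T` stands in for the priority removed last: it bounds the only priority
    -- present, and it is where the first insertion leaves `top`.
    initialInvariant : ∀ {T σ} → Initialized T σ →
      Invariant T (const nothing) T 0 (updateAt (const nothing) p (const (just T))) σ
    initialInvariant {T} {σ} (F-≡ , r′-≡ , t-≡) = record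
      { F-≡ = F-≡ ; t-p = trans (t-≡ p) (updateAt-updates p (const 0ℤ)) ; b≤T = ℕ.≤-refl
      ; count = ℕ.≤-refl ; status = status }
      where
      status : ∀ v → Status (const nothing) T 0 v (r′ σ v) (t σ v) (parent σ v) nothing
                       (updateAt (const nothing) p (const (just T)) v)
      status v with v Fin.≟ p | t-≡ v
      ... | yes refl | t≡ rewrite updateAt-updates p {const (just T)} (const nothing) =
        queued (r′-≡ v) (trans t≡ (updateAt-updates p (const 0ℤ))) ℕ.≤-refl (inj₁ refl)
      ... | no v≢p | t≡ rewrite updateAt-minimal v p {const (just T)} (const nothing) v≢p =
        idle (r′-≡ v) (trans t≡ (updateAt-minimal v p (const 0ℤ) v≢p))

    -- `T * 60` pays for the one climb of `top`, the only place where the slack enters the running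
    -- time.
    initializeCost : ℕ → ℕ → ℕ
    initializeCost T N = suc (length (allFin m) * 2) + (suc (length (allFin n) * 3) +
      (2 + (30 + (n * 15 + (81 + (T * 60 + N))))))

    runInitialize : ∀ T M {σ} → r s ℤ.- r p ℤ.- 1ℤ ≡ + T →
      Run (initialize bucketQueue G L H r pₛ) σ (initializeCost T (160 + (totalWeight + M)))
        λ j _ σ → Loop T M j σ
    runInitialize T M gap = chain (payForEach copying 1
      (λ { {e} {σ = σ} (copied , credit) → pay
           ((λ e′ → copy e e′ (F σ) (copied e′)) , credit) })
      (λ { (copied , credit) → weaken credit (chain (payForEach resetting 2
        (λ { {v} {σ = σ} (F-≡ , reset , credit) → payThen (pay
             (F-≡ , (λ v′ → resets v v′ (r′ σ) (t σ) (reset v′)) , credit)) })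
        (λ { {σ = σ} (F-≡ , reset , credit) → weaken credit (payThen (payThen (chain (runOnQueue
          (mono
            (λ { (rep , credit) → weaken credit (chain (runOnQueue (mono
              (λ { (i , refl , B , rep , credit) → pay record
                { inv = initialInvariant
                    ( F-≡ , (λ v → proj₁ (discard (reset v)))
                    , λ v → raise v (t σ) (λ v → proj₂ (discard (reset v))) )
                ; rep = rep ; credit = credit } })
              (frame 1 (enqueue gap rep))))) })
            (runInit n (81 + (T * 60 + (160 + (totalWeight + M)))))))))) })
        (allFin n) ((λ e → discard (copied e)) , (λ v → inj₁ (∈-allFin v)) , ℕ.≤-refl))) })
      (allFin m) ((λ e → inj₁ (∈-allFin e)) , ℕ.≤-refl))
      where
      N₂ = 2 + (30 + (n * 15 + (81 + (T * 60 + (160 + (totalWeight + M))))))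
      N₁ = suc (length (allFin n) * 3) + N₂
      enqueue : ∀ {q τ} → τ ≡ + T → Rep n (const nothing) 0 (const []) q →
        Run (call insert (+ toℕ p) τ) q (80 + (T * 60 + (160 + (totalWeight + M)))) λ j _ q →
          ∃[ B ] Rep n (updateAt (const nothing) p (const (just T))) T B q ×
            potential B T * 30 + (160 + (totalWeight + M)) ≤ j
      enqueue refl rep = runInsert (160 + (totalWeight + M)) p T rep
      copying : List Edge → ℕ → St → Set
      copying es j σ = (∀ e → e ∈ es ⊎ lookup (F σ) e ≡ lookup H e) × N₁ ≤ j
      resetting : List Vertex → ℕ → St → Set
      resetting vs j σ = (∀ e → lookup (F σ) e ≡ lookup H e) ×
        (∀ v → v ∈ vs ⊎ (r′ σ v ≡ r v × t σ v ≡ 0ℤ)) × N₂ ≤ j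
      discard : ∀ {A B : Set} {x : A} → x ∈ [] ⊎ B → B
      discard (inj₂ b) = b
      copy : ∀ e e′ {es} (F : Subset m) → e′ ∈ e ∷ es ⊎ lookup F e′ ≡ lookup H e′ →
             e′ ∈ es ⊎ lookup (F [ e ]≔ lookup H e) e′ ≡ lookup H e′
      copy e e′ F (inj₁ (there e′∈)) = inj₁ e′∈
      copy e e′ F (inj₁ (here refl)) = inj₂ (lookup∘update e F (lookup H e))
      copy e e′ F (inj₂ eq) with e′ Fin.≟ e
      ... | yes refl = inj₂ (lookup∘update e F (lookup H e))
      ... | no e′≢e = inj₂ (trans (lookup∘update′ e′≢e F (lookup H e)) eq)
      resets : ∀ v v′ {vs} (ρ τ : Vertex → ℤ) → v′ ∈ v ∷ vs ⊎ (ρ v′ ≡ r v′ × τ v′ ≡ 0ℤ) →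
               v′ ∈ vs ⊎ (updateAt ρ v (const (r v)) v′ ≡ r v′ × updateAt τ v (const 0ℤ) v′ ≡ 0ℤ)
      resets v v′ ρ τ (inj₁ (there v′∈)) = inj₁ v′∈
      resets v v′ ρ τ (inj₁ (here refl)) = inj₂ (updateAt-updates v ρ , updateAt-updates v τ)
      resets v v′ ρ τ (inj₂ (ρ≡ , τ≡)) with v′ Fin.≟ v
      ... | yes refl = inj₂ (updateAt-updates v ρ , updateAt-updates v τ)
      ... | no v′≢v = inj₂ (trans (updateAt-minimal v′ v ρ v′≢v) ρ≡ , trans (updateAt-minimal v′ v τ v′≢v) τ≡)
      raise : ∀ v (τ : Vertex → ℤ) → (∀ v → τ v ≡ 0ℤ) →
              updateAt τ p (const (r s ℤ.- r p ℤ.- 1ℤ)) v ≡ updateAt (const 0ℤ) p (const (+ T)) v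
      raise v τ τ≡0 with v Fin.≟ p
      ... | yes refl = trans (updateAt-updates p τ) (trans gap (sym (updateAt-updates p (const 0ℤ))))
      ... | no v≢p = trans (updateAt-minimal v p τ v≢p)
                       (trans (τ≡0 v) (sym (updateAt-minimal v p (const 0ℤ) v≢p)))

    -- The total cost.

    reliefCost : ℕ → ℕ
    reliefCost T = initializeCost T (160 + (totalWeight + (1 + augmentCost 0)))

    runRelief : ∀ {T σ} → Conforms r H → 0 < T → r s ℤ.- r p ℤ.- 1ℤ ≡ + T →
                Run (relief bucketQueue G L H r pₛ) σ (reliefCost T) λ _ _ _ → ⊤
    runRelief {T} conforms 0<T gap = chain (mono
      (λ ℓ → chain (mono finish (runMainLoop conforms ℓ)))
      (runInitialize T (1 + augmentCost 0) gap))
      where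
      finish : ∀ {j σ} → Drained T (1 + augmentCost 0) j σ →
        Run (read (λ σ → ⌊ 0ℤ ℤ.<? slack pₛ (r′ σ) ⌋) >>= λ positive → when positive (augment bucketQueue G L pₛ))
          σ j λ _ _ _ → ⊤
      finish {σ = σ} record { ord = ord ; inv = I ; empty = empty ; credit = credit } =
        weaken credit (payThen (runWhen _
          (λ positive → let _ , at = s-removed (⌊⌋-true (0ℤ ℤ.<? slack pₛ (r′ σ)) positive)
                        in runAugment I at)
          (pay tt)))
        where
        open Invariant I
        p-removed : ∀ {o q} → Status ord _ _ p (r′ σ p) (t σ p) (parent σ p) o q → q ≡ nothing →
                    r′ σ p ≡ r p ℤ.+ + T
        p-removed (popped ρ≡ _ _ _) _ = trans ρ≡ (cong (λ τ → r p ℤ.+ τ) t-p)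
        -- `p` is not waiting, as the queue is empty, and not idle, as `t p` is positive.
        p-removed (idle _ τ≡) _ = contradiction (ℤ.+-injective (trans (sym t-p) τ≡)) (ℕ.>⇒≢ 0<T)
        -- `p` rose by exactly the gap `T`, so the slack would be 0 had `s` kept its rank.
        s-removed : 0ℤ ℤ.< slack pₛ (r′ σ) → ∃[ i ] ord s ≡ just i
        s-removed 0<slack with ord s in eq
        ... | just i = i , refl
        ... | nothing = contradiction (subst (0ℤ ℤ.<_) closed 0<slack) (ℤ.<-irrefl refl)
          where
          cancel : ∀ a b c → b ℤ.- (a ℤ.+ c) ℤ.- 1ℤ ≡ b ℤ.- a ℤ.- 1ℤ ℤ.- c
          cancel = ℤSolver.solve-∀
          closed : slack pₛ (r′ σ) ≡ 0ℤ
          closed = begin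
            (r′ σ s ℤ.- r′ σ p ℤ.- 1ℤ) ℤ.⊔ 0ℤ       ≡⟨ cong₂ (λ a b → (a ℤ.- b ℤ.- 1ℤ) ℤ.⊔ 0ℤ)
                                                       (untouched (status s) eq)
                                                       (p-removed (status p) (empty p)) ⟩
            (r s ℤ.- (r p ℤ.+ + T) ℤ.- 1ℤ) ℤ.⊔ 0ℤ   ≡⟨ cong (ℤ._⊔ 0ℤ) (cancel (r p) (r s) (+ T)) ⟩
            (r s ℤ.- r p ℤ.- 1ℤ ℤ.- + T) ℤ.⊔ 0ℤ     ≡⟨ cong (λ g → (g ℤ.- + T) ℤ.⊔ 0ℤ) gap ⟩
            (+ T ℤ.- + T) ℤ.⊔ 0ℤ                    ≡⟨ cong (ℤ._⊔ 0ℤ) (ℤ.+-inverseʳ (+ T)) ⟩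
            0ℤ                                      ∎
            where open ≡-Reasoning

    totalWeight-≡ : totalWeight ≡ n * 165 + (m * 88 + m * 88)
    totalWeight-≡ = begin
      totalWeight
        ≡⟨ sum-linear 165 88 (λ v → length (out v)) (λ v → length (inn v)) ⟩
      n * 165 + (sum (λ v → length (out v)) * 88 + sum (λ v → length (inn v)) * 88)
        ≡⟨ cong₂ (λ x y → n * 165 + (x * 88 + y * 88)) outs inns ⟩
      n * 165 + (m * 88 + m * 88)
        ∎
      where
      open ≡-Reasoning
      outs : sum (λ v → length (out v)) ≡ m
      outs = trans (sum-cong-≗ (λ v → ↭-length (out-↭ v))) (sum-allFin src)
      inns : sum (λ v → length (inn v)) ≡ m
      inns = trans (sum-cong-≗ (λ v → ↭-length (inn-↭ v))) (sum-allFin tgt)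

    -- The total weight is counted five times, once for the main loop and four times for the walk:
    -- 843 = 5 * 165 + 15 + 3 and 886 = 5 * 176 + 6.
    reliefCost-≡ : ∀ T → reliefCost T ≡ n * 843 + (m * 886 + (T * 60 + 282))
    reliefCost-≡ T = begin
      closed (length (allFin m)) (length (allFin n)) totalWeight
        ≡⟨ cong₂ (λ x y → closed x y totalWeight) (length-allFin m) (length-allFin n) ⟩
      closed m n totalWeight
        ≡⟨ cong (closed m n) {totalWeight} totalWeight-≡ ⟩
      closed m n (n * 165 + (m * 88 + m * 88))
        ≡⟨ collect m n T ⟩
      n * 843 + (m * 886 + (T * 60 + 282))
        ∎
      where
      open ≡-Reasoning
      closed : ℕ → ℕ → ℕ → ℕ
      closed x y w = suc (x * 2) + (suc (y * 3) + (2 + (30 + (n * 15 + (81 + (T * 60 + (160 + (w + (1 +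
        (suc (x * 2) + (1 + (2 + (w * 4 + (suc (x * 2) + (1 + 0)))))))))))))))
      collect : ∀ m n T → let w = n * 165 + (m * 88 + m * 88) in
        suc (m * 2) + (suc (n * 3) + (2 + (30 + (n * 15 + (81 + (T * 60 + (160 + (w + (1 +
        (suc (m * 2) + (1 + (2 + (w * 4 + (suc (m * 2) + (1 + 0)))))))))))))))
        ≡ n * 843 + (m * 886 + (T * 60 + 282))
      collect = solve-∀

    -- 1228 = 886 + 60 + 282. The additive constant 282 is absorbed because `T` is at least 1.
    reliefCost-≤ : ∀ c T → n ≤ c * m → 0 < T → reliefCost T ≤ (c * 843 + 1228) * (m + T)
    reliefCost-≤ c T n≤cm 0<T = begin
      reliefCost T
        ≡⟨ reliefCost-≡ T ⟩
      n * 843 + (m * 886 + (T * 60 + 282))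
        ≤⟨ ℕ.+-mono-≤ (ℕ.*-monoˡ-≤ 843 n≤cm)
             (ℕ.+-monoʳ-≤ (m * 886) (ℕ.+-monoʳ-≤ (T * 60) (ℕ.*-monoˡ-≤ 282 0<T))) ⟩
      c * m * 843 + (m * 886 + (T * 60 + T * 282))
        ≤⟨ ℕ.m≤m+n _ (m * 342 + T * (c * 843 + 886)) ⟩
      c * m * 843 + (m * 886 + (T * 60 + T * 282)) + (m * 342 + T * (c * 843 + 886))
        ≡⟨ expand c m T ⟩
      (c * 843 + 1228) * (m + T)
        ∎
      where
      open ℕ.≤-Reasoning
      expand : ∀ c m T → c * m * 843 + (m * 886 + (T * 60 + T * 282)) + (m * 342 + T * (c * 843 + 886)) ≡
               (c * 843 + 1228) * (m + T)
      expand = solve-∀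

open Analysis

open import Data.Fin.Subset using (_∈_)
open import Data.Integer using (+_; 0ℤ; _+_; _*_; _≤_; _<_)
open Graph using (n; m; Subgraph; Rank; Edge; MaximalEulerian; Conforms; slack)

proposition4 : Σ[ PQ ∈ PriorityQueue ] ((c : ℕ) → Σ[ C ∈ ℕ ]
    ((G : Graph) (L : AdjacencyLists G) (H : Subgraph G) (r : Rank G) (pₛ : Edge G) →
    n G ℕ.≤ c ℕ.* m G →
    MaximalEulerian G H →
    Conforms G r H →
    pₛ ∈ H →
    0ℤ < slack G pₛ r →
    (σ : State PQ G L) →
    ∃[ k ] ∃[ σ′ ]
    (relief PQ G L H r pₛ σ k tt σ′ ×
    + k ≤ + C * (+ m G + slack G pₛ r))))
proposition4 = bucketQueue , λ c → c ℕ.* 843 ℕ.+ 1228 , λ G L H r pₛ n≤cm _ conforms _ 0<slack σ →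
  let T , gap , 0<T , slack≡T = positivePart 0<slack
      C = c ℕ.* 843 ℕ.+ 1228
      run {k} {credits = j} h k+j≤cost _ = runRelief G L H r pₛ {σ = σ} conforms 0<T gap
      k≤ = ℕ.≤-trans (ℕ.m+n≤o⇒m≤o k k+j≤cost) (reliefCost-≤ G L H r pₛ c T n≤cm 0<T)
  in k , _ , h , subst (λ z → + k ≤ + C * (+ m G + z)) (sym slack≡T)
       (subst (λ z → + k ≤ z) (ℤ.pos-* C (m G ℕ.+ T)) (ℤ.+≤+ k≤))
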